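{- Let $n\ge2$ and $1\le k\le n/2$. The total number of splits of the hypersimplex $\Delta(k,n)$ equals $$(k-1)\bigl(2^{n-1}-(n+1)\bigr)-\sum_{i=2}^{k-1}(k-i)\binom{n}{i}.$$
   Context: $\Delta(k,n)=\mathrm{conv}\{\sum_{i\in A}e_i:A\subseteq[n],\#A=k\}\subset\mathbb R^n$. A split of a polytope $P$ is a polytopal subdivision of $P$ without new vertices (all vertices are vertices of $P$) that has exactly two maximal cells.
   Formalization: The hypersimplex, the cells of a split and the hyperplanes defining their faces are taken in rational space ℚ^n (rational points, weights and functionals) instead of ℝ^n; all the polytopes involved have 0/1 vertices. -}

module Defs where

open import Data.Nat as ℕ using (ℕ; zero; suc)
open import Data.Nat.Combinatorics using (_C_)
open import Data.Integer as ℤ using (ℤ; +_)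
open import Data.Rational as ℚ using (ℚ; 0ℚ; 1ℚ)
open import Data.Bool using (Bool; true; false; if_then_else_)
open import Data.Fin using (Fin)
import Data.Fin as Fin
open import Data.Fin.Subset using (Subset; ∣_∣)
open import Data.Vec using (Vec; []; _∷_; lookup)
open import Data.List using (List; []; _∷_; map; upTo; length)
open import Data.Nat.ListAction using (sum)
open import Data.List.Relation.Unary.All using (All)
open import Data.List.Relation.Unary.AllPairs using (AllPairs)
open import Data.List.Membership.Propositional using (_∈_)
open import Data.Product using (Σ; ∃; _×_; _,_; proj₁; proj₂)
open import Data.Sum using (_⊎_)
open import Relation.Nullary using (¬_)
open import Relation.Binary.PropositionalEquality using (_≡_)

-- Points of ℚ^n (rational points suffice for rational polytopes)

Point : ℕ → Set
Point n = Fin n → ℚ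

dot : ∀ {n} → Point n → Point n → ℚ
dot {zero}  x y = 0ℚ
dot {suc n} x y = x Fin.zero ℚ.* y Fin.zero ℚ.+ dot (λ i → x (Fin.suc i)) (λ i → y (Fin.suc i))

indicator : ∀ {n} → Subset n → Point n
indicator A i = if lookup A i then 1ℚ else 0ℚ

PSet : ℕ → Set₁
PSet n = Point n → Set

wsum : ∀ {n} → List (ℚ × Subset n) → Fin n → ℚ
wsum []             i = 0ℚ
wsum ((w , A) ∷ ws) i = w ℚ.* indicator A i ℚ.+ wsum ws i

wtotal : ∀ {n} → List (ℚ × Subset n) → ℚ
wtotal []             = 0ℚ
wtotal ((w , A) ∷ ws) = w ℚ.+ wtotal ws

conv : ∀ {n} → (Subset n → Set) → PSet n
conv S x = Σ (List (ℚ × Subset _)) λ ws →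
  All (λ p → (0ℚ ℚ.≤ proj₁ p) × S (proj₂ p)) ws
  × wtotal ws ≡ 1ℚ
  × (∀ i → wsum ws i ≡ x i)

Hypersimplex : (k n : ℕ) → PSet n
Hypersimplex k n = conv (λ (A : Subset n) → ∣ A ∣ ≡ k)

-- F is a face of the polytope Q: F = Q ∩ {a·x = b} for a valid inequality a·x ≤ b
-- (includes the empty face and Q itself).
IsFace : ∀ {n} → PSet n → PSet n → Set
IsFace {n} Q F = Σ (Point n) λ a → Σ ℚ λ b →
  (∀ x → Q x → dot a x ℚ.≤ b)
  × (∀ x → (F x → Q x × dot a x ≡ b) × (Q x × dot a x ≡ b → F x))

-- Finite sets of vertices of the cube {0,1}^n, as complete binary tables
-- indexed by Subset n (a decidable-equality representation of subsets of 2^[n]).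

Table : ℕ → Set
Table zero    = Bool
Table (suc n) = Table n × Table n

_∈T_ : ∀ {n} → Subset n → Table n → Set
_∈T_ {zero}  []          b         = b ≡ true
_∈T_ {suc n} (false ∷ A) (t₀ , t₁) = A ∈T t₀
_∈T_ {suc n} (true  ∷ A) (t₀ , t₁) = A ∈T t₁

cell : ∀ {n} → Table n → PSet n
cell T = conv (λ A → A ∈T T)

_⊆P_ : ∀ {n} → PSet n → PSet n → Set
P ⊆P Q = ∀ x → P x → Q x

_∩P_ : ∀ {n} → PSet n → PSet n → PSet n
(P ∩P Q) x = P x × Q x

-- (T₁ , T₂) are the two maximal cells of a split of Δ(k,n):
-- vertices of the cells are vertices of Δ(k,n) (no new vertices),
-- the cells cover Δ(k,n), they meet in a common face, and neither
-- contains the other (so they are exactly two distinct maximal cells;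
-- the subdivision is then the collection of all their faces).
IsSplit : (k n : ℕ) → Table n × Table n → Set
IsSplit k n (T₁ , T₂) =
    (∀ A → A ∈T T₁ → ∣ A ∣ ≡ k)
  × (∀ A → A ∈T T₂ → ∣ A ∣ ≡ k)
  × (Hypersimplex k n ⊆P (λ x → cell T₁ x ⊎ cell T₂ x))
  × IsFace (cell T₁) (cell T₁ ∩P cell T₂)
  × IsFace (cell T₂) (cell T₁ ∩P cell T₂)
  × ¬ (cell T₁ ⊆P cell T₂)
  × ¬ (cell T₂ ⊆P cell T₁)

SameSplit : ∀ {n} → Table n × Table n → Table n × Table n → Set
SameSplit (A , B) (C , D) = ((A ≡ C) × (B ≡ D)) ⊎ ((A ≡ D) × (B ≡ C))

SplitList : (k n : ℕ) → List (Table n × Table n) → Set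
SplitList k n L =
    All (IsSplit k n) L
  × (∀ s → IsSplit k n s → Σ (Table n × Table n) λ t → t ∈ L × SameSplit s t)
  × AllPairs (λ s t → ¬ SameSplit s t) L

-- Σ_{i=2}^{k-1} (k-i) binom(n,i), written with i = j+2, j = 0 .. k-3
sumTerm : (k n : ℕ) → ℕ
sumTerm k n = sum (map (λ j → (k ℕ.∸ (j ℕ.+ 2)) ℕ.* (n C (j ℕ.+ 2))) (upTo (k ℕ.∸ 2)))

splitCount : (k n : ℕ) → ℤ
splitCount k n =
  (+ (k ℕ.∸ 1)) ℤ.* ((+ (2 ℕ.^ (n ℕ.∸ 1))) ℤ.- (+ (n ℕ.+ 1))) ℤ.- (+ sumTerm k n)

{-# OPTIONS --safe #-}

-- The splits of Δ(k,n) are cut out by the hyperplanes Σ_{i∈A} x_i = j with 1 ≤ j < k, j < |A| and k - j < |∁A|;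
-- (A , j) and (∁ A , k - j) describe the same one, and it is normalised by 0 ∈ A.
--
-- Such a hyperplane gives a split: in a convex combination of vertices, one vertex above and one below the
-- hyperplane can trade elements i ∈ A and l ∉ A without changing the sum, which moves both closer to it, so in the
-- end all vertices lie weakly on one side.
--
-- Conversely let a·x ≤ b define the common face of a split. By looking at midpoints of edges, no edge
-- of Δ(k,n) joins a vertex with a·x < b to one with a·x > b. At a vertex S on the hyperplane this forbids
-- a y < a x < a y' for x ∈ S and y, y' ∉ S, and dually, while both increasing and decreasing exchanges exist at S;
-- hence a takes exactly two values, and A is the set where the larger one is taken.
--
-- Counting: for fixed j, the sets A' = A \ {0} violating a bound are those with |A'| < j or |∁A'| ≤ k - j.
-- Reversing the sum over j in the second family and applying Pascal's rule gives Σ_j Σ_{i≤j} binom(n,i).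
module Submission where

open import Defs
open import Data.Bool using (Bool; true; false; not; if_then_else_)
import Data.Bool as Bool
open import Data.Fin using (Fin; zero; suc)
import Data.Fin as Fin
open import Data.Fin.Subset using (Subset; ∣_∣; _∩_; ∁; ⊥; ⊤)
open import Data.Fin.Subset.Properties using (∩-identityʳ; ∣⊥∣≡0; anySubset?)
open import Data.List using (List; []; _∷_; map; _++_; length; upTo)
open import Data.List.Membership.Propositional using (_∈_)
open import Data.List.Relation.Unary.All as All using (All; []; _∷_)
open import Data.List.Relation.Unary.Any using (here; there)
open import Data.Nat using (ℕ; zero; suc; z≤n; s≤s; _∸_)
open import Data.Product using (Σ; ∃; ∃₂; _×_; _,_; proj₁; proj₂)
open import Data.Sum as Sum using (_⊎_; inj₁; inj₂; [_,_]′)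
open import Data.Vec using ([]; _∷_; lookup; tabulate; _[_]≔_)
open import Data.Vec.Properties using (lookup∘updateAt; lookup∘updateAt′; lookup-map; lookup-replicate; lookup∘tabulate)
open import Function using (_∘_)
open import Relation.Binary.Definitions using (Tri; tri<; tri≈; tri>)
open import Relation.Binary.PropositionalEquality
open import Relation.Nullary using (¬_; Dec; yes; no; does; ¬?; contradiction)
open import Relation.Nullary.Decidable using (_×-dec_; dec-true; decidable-stable)

-- The inequality that defines the common face is valid on the first cell only; nothing in the
-- definition of a split places the second cell on the other side. This has to be extracted from the
-- edges: a vertex of the second cell alone with value below `b` and a vertex of the first cell
-- alone can be walked towards each other by exchanges that never raise a value, and as long as
-- values stay below `b` neither walk can enter the other cell, so the two could never meet.
--
-- For the covering of the hypersimplex the obstacle is the weights: two vertices that trade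
-- elements usually carry different ones. Only the smaller weight is traded and the leftover is put
-- back, so the number of items may grow. What decreases is a bound on how far the combination
-- reaches above plus how far it reaches below the hyperplane.
--
-- Passing from points back to vertices rests on the values 0 and 1 being extremal for every
-- coordinate: a point with enough coordinates of this kind determines the vertices that can
-- represent it.

private variable
  n : ℕ

-- Subsets: counting inside a fixed set, exchanges, and distance

module Exchanges where
  open import Data.Nat using (_+_; _≤_; _<_)
  open import Data.Nat.Properties hiding (_≟_)

  true≢false : true ≢ false
  true≢false ()

  _∈ᵇ_ _∉ᵇ_ : Fin n → Subset n → Set
  i ∈ᵇ S = lookup S i ≡ true
  i ∉ᵇ S = lookup S i ≡ false

  ∈∉-≢ : ∀ {S : Subset n} {i j} → i ∈ᵇ S → j ∉ᵇ S → i ≢ j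
  ∈∉-≢ i∈ j∉ refl = true≢false (trans (sym i∈) j∉)

  ∈-or-∉ : (S : Subset n) (i : Fin n) → (i ∈ᵇ S) ⊎ (i ∉ᵇ S)
  ∈-or-∉ S i with lookup S i
  ... | true  = inj₁ refl
  ... | false = inj₂ refl

  ∈∩ : ∀ (S A : Subset n) {i} → i ∈ᵇ (S ∩ A) → i ∈ᵇ S × i ∈ᵇ A
  ∈∩ (true ∷ S) (true ∷ A) {zero} refl = refl , refl
  ∈∩ (x ∷ S) (y ∷ A) {suc i} e = ∈∩ S A e

  ∉∩ : ∀ (S A : Subset n) {i} → i ∉ᵇ (S ∩ A) → i ∈ᵇ A → i ∉ᵇ S
  ∉∩ (false ∷ S) (a ∷ A) {zero} e _ = refl
  ∉∩ (true ∷ S) (true ∷ A) {zero} ()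
  ∉∩ (true ∷ S) (false ∷ A) {zero} _ ()
  ∉∩ (x ∷ S) (y ∷ A) {suc i} e = ∉∩ S A e

  ∈∁ : ∀ (A : Subset n) {i} → i ∈ᵇ ∁ A → i ∉ᵇ A
  ∈∁ (false ∷ A) {zero} e = refl
  ∈∁ (x ∷ A) {suc i} e = ∈∁ A e

  ∉⇒∈∁ : ∀ (A : Subset n) {i} → i ∉ᵇ A → i ∈ᵇ ∁ A
  ∉⇒∈∁ (false ∷ A) {zero} e = refl
  ∉⇒∈∁ (x ∷ A) {suc i} e = ∉⇒∈∁ A e

  ∁-involutive : (A : Subset n) → ∁ (∁ A) ≡ A
  ∁-involutive [] = refl
  ∁-involutive (true ∷ A) = cong (true ∷_) (∁-involutive A)
  ∁-involutive (false ∷ A) = cong (false ∷_) (∁-involutive A)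

  lookup-ext : (S S' : Subset n) → (∀ p → lookup S p ≡ lookup S' p) → S ≡ S'
  lookup-ext [] [] h = refl
  lookup-ext (x ∷ S) (y ∷ S') h = cong₂ _∷_ (h zero) (lookup-ext S S' (h ∘ suc))

  cnt : Subset n → Subset n → ℕ
  cnt A S = ∣ S ∩ A ∣

  cnt-∁ : (A S : Subset n) → cnt A S + cnt (∁ A) S ≡ ∣ S ∣
  cnt-∁ [] [] = refl
  cnt-∁ (a ∷ A) (false ∷ S) = cnt-∁ A S
  cnt-∁ (true ∷ A) (true ∷ S) = cong suc (cnt-∁ A S)
  cnt-∁ (false ∷ A) (true ∷ S) = trans (+-suc _ _) (cong suc (cnt-∁ A S))

  cnt≤ : (A S : Subset n) → cnt A S ≤ ∣ S ∣
  cnt≤ A S = subst (cnt A S ≤_) (cnt-∁ A S) (m≤m+n _ _)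

  bit : Bool → ℕ
  bit true  = 1
  bit false = 0

  record Off (S S' : Subset n) (i : Fin n) : Set where
    constructor off
    field
      i∈   : i ∈ᵇ S
      i∉   : i ∉ᵇ S'
      same : ∀ p → p ≢ i → lookup S p ≡ lookup S' p

  off-tail : ∀ {x y} {S S' : Subset n} {i} → Off (x ∷ S) (y ∷ S') (suc i) → (x ≡ y) × Off S S' i
  off-tail (off a b c) = c zero (λ ()) , off a b (λ p p≢ → c (suc p) (λ { refl → p≢ refl }))

  off-head : ∀ {x y} {S S' : Subset n} → Off (x ∷ S) (y ∷ S') zero → S ≡ S'
  off-head (off a b c) = lookup-ext _ _ (λ p → c (suc p) (λ ()))

  cnt-off : (A S S' : Subset n) {i : Fin n} → Off S S' i → cnt A S ≡ bit (lookup A i) + cnt A S'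
  cnt-off (a ∷ A) (x ∷ S) (y ∷ S') {zero} o with Off.i∈ o | Off.i∉ o | off-head o
  cnt-off (true ∷ A) (x ∷ S) (y ∷ S') {zero} o | refl | refl | refl = refl
  cnt-off (false ∷ A) (x ∷ S) (y ∷ S') {zero} o | refl | refl | refl = refl
  cnt-off (a ∷ A) (x ∷ S) (y ∷ S') {suc i} o with off-tail o
  cnt-off (a ∷ A) (false ∷ S) (y ∷ S') {suc i} o | refl , o' = cnt-off A S S' o'
  cnt-off (false ∷ A) (true ∷ S) (y ∷ S') {suc i} o | refl , o' = cnt-off A S S' o'
  cnt-off (true ∷ A) (true ∷ S) (y ∷ S') {suc i} o | refl , o' =
    trans (cong suc (cnt-off A S S' o')) (sym (+-suc _ _))

  card-off : (S S' : Subset n) {i : Fin n} → Off S S' i → ∣ S ∣ ≡ suc ∣ S' ∣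
  card-off S S' {i} o = begin
    ∣ S ∣                       ≡⟨ cong ∣_∣ (∩-identityʳ S) ⟨
    cnt ⊤ S                     ≡⟨ cnt-off ⊤ S S' o ⟩
    bit (lookup ⊤ i) + cnt ⊤ S' ≡⟨ cong₂ _+_ (cong bit (lookup-replicate i true)) (cong ∣_∣ (∩-identityʳ S')) ⟩
    suc ∣ S' ∣                  ∎
    where open ≡-Reasoning

  -- S' arises from S by exchanging i ∈ S for j ∉ S: the two vertices span an edge of the hypersimplex.
  record Adj (S S' : Subset n) (i j : Fin n) : Set where
    constructor adj
    field
      i∈   : i ∈ᵇ S
      j∉   : j ∉ᵇ S
      i∉   : i ∉ᵇ S'
      j∈   : j ∈ᵇ S'
      same : ∀ p → p ≢ i → p ≢ j → lookup S p ≡ lookup S' p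

  -- An exchange is two removals with the same result `M`, so every quantity that is additive over
  -- elements is compared across an exchange by two single-element steps.
  adj-middle : ∀ {S S' : Subset n} {i j} → Adj S S' i j → Σ (Subset n) λ M → Off S M i × Off S' M j
  adj-middle {S = S} {S'} {i} {j} (adj i∈ j∉ i∉ j∈ same) =
    M , off i∈ (lookup∘updateAt i S) (λ p p≢i → sym (lookup∘updateAt′ p i p≢i S))
      , off j∈ (trans (lookup∘updateAt′ j i (λ e → ∈∉-≢ {S = S} i∈ j∉ (sym e)) S) j∉) same'
    where
    M = S [ i ]≔ false
    same' : ∀ p → p ≢ j → lookup S' p ≡ lookup M p
    same' p p≢j with p Fin.≟ i
    ... | yes refl = trans i∉ (sym (lookup∘updateAt i S))
    ... | no p≢i = trans (sym (same p p≢i p≢j)) (sym (lookup∘updateAt′ p i p≢i S))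

  cnt-adj : (A : Subset n) {S S' : Subset n} {i j : Fin n} → Adj S S' i j →
            bit (lookup A j) + cnt A S ≡ bit (lookup A i) + cnt A S'
  cnt-adj A {S} {S'} {i} {j} e with adj-middle e
  ... | M , o , o' = begin
    bit (lookup A j) + cnt A S                      ≡⟨ cong (bit (lookup A j) +_) (cnt-off A _ _ o) ⟩
    bit (lookup A j) + (bit (lookup A i) + cnt A M) ≡⟨ x∙yz≈y∙xz (bit (lookup A j)) (bit (lookup A i)) (cnt A M) ⟩
    bit (lookup A i) + (bit (lookup A j) + cnt A M) ≡⟨ cong (bit (lookup A i) +_) (cnt-off A _ _ o') ⟨
    bit (lookup A i) + cnt A S'                     ∎
    where
    open ≡-Reasoning
    open import Algebra.Properties.CommutativeSemigroup +-commutativeSemigroup using (x∙yz≈y∙xz)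

  card-adj : {S S' : Subset n} {i j : Fin n} → Adj S S' i j → ∣ S' ∣ ≡ ∣ S ∣
  card-adj e with adj-middle e
  ... | M , o , o' = trans (card-off _ _ o') (sym (card-off _ _ o))

  swap : Subset n → Fin n → Fin n → Subset n
  swap S i j = (S [ i ]≔ false) [ j ]≔ true

  swap-out : (S : Subset n) {i j : Fin n} → i ≢ j → i ∉ᵇ swap S i j
  swap-out S {i} {j} i≢j = trans (lookup∘updateAt′ i j i≢j (S [ i ]≔ false)) (lookup∘updateAt i S)

  swap-in : (S : Subset n) {i j : Fin n} → j ∈ᵇ swap S i j
  swap-in S {i} {j} = lookup∘updateAt j (S [ i ]≔ false)

  swap-other : (S : Subset n) {i j p : Fin n} → p ≢ i → p ≢ j → lookup (swap S i j) p ≡ lookup S p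
  swap-other S {i} {j} {p} p≢i p≢j =
    trans (lookup∘updateAt′ p j p≢j (S [ i ]≔ false)) (lookup∘updateAt′ p i p≢i S)

  swap-adj : (S : Subset n) {i j : Fin n} → i ∈ᵇ S → j ∉ᵇ S → Adj S (swap S i j) i j
  swap-adj S i∈ j∉ = adj i∈ j∉ (swap-out S (∈∉-≢ {S = S} i∈ j∉)) (swap-in S)
    (λ p p≢i p≢j → sym (swap-other S p≢i p≢j))

  -- An inequality of sizes keeps the induction going: skipping a position that only `Z` contains
  -- leaves a strict inequality, which also rules out the equality outcome there.
  diff-≤ : (Y Z : Subset n) → ∣ Z ∣ ≤ ∣ Y ∣ → Y ≡ Z ⊎ ∃ λ i → i ∈ᵇ Y × i ∉ᵇ Z
  diff-≤ [] [] _ = inj₁ refl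
  diff-≤ (true ∷ Y) (false ∷ Z) h = inj₂ (zero , refl , refl)
  diff-≤ (true ∷ Y) (true ∷ Z) (s≤s h) with diff-≤ Y Z h
  ... | inj₁ e = inj₁ (cong (true ∷_) e)
  ... | inj₂ (i , p) = inj₂ (suc i , p)
  diff-≤ (false ∷ Y) (false ∷ Z) h with diff-≤ Y Z h
  ... | inj₁ e = inj₁ (cong (false ∷_) e)
  ... | inj₂ (i , p) = inj₂ (suc i , p)
  diff-≤ (false ∷ Y) (true ∷ Z) h with diff-≤ Y Z (<⇒≤ h)
  ... | inj₁ refl = contradiction h (<-irrefl refl)
  ... | inj₂ (i , p) = inj₂ (suc i , p)

  diff-≡ : (Y Z : Subset n) → ∣ Y ∣ ≡ ∣ Z ∣ →
           Y ≡ Z ⊎ ∃₂ λ i j → (i ∈ᵇ Y × i ∉ᵇ Z) × (j ∈ᵇ Z × j ∉ᵇ Y)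
  diff-≡ Y Z e with diff-≤ Y Z (≤-reflexive (sym e)) | diff-≤ Z Y (≤-reflexive e)
  ... | inj₁ p | _ = inj₁ p
  ... | inj₂ _ | inj₁ p = inj₁ (sym p)
  ... | inj₂ (i , p) | inj₂ (j , q) = inj₂ (i , j , p , q)

  excess : (A S S' : Subset n) → cnt A S' < cnt A S → ∃ λ i → i ∈ᵇ A × i ∈ᵇ S × i ∉ᵇ S'
  excess A S S' h with diff-≤ (S ∩ A) (S' ∩ A) (<⇒≤ h)
  ... | inj₁ e = contradiction (cong ∣_∣ (sym e)) (<⇒≢ h)
  ... | inj₂ (i , p , q) = i , proj₂ (∈∩ S A p) , proj₁ (∈∩ S A p) , ∉∩ S' A q (proj₂ (∈∩ S A p))

  -- The termination measure of all walks from one vertex towards another.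
  hamming : Subset n → Subset n → ℕ
  hamming [] [] = 0
  hamming (true  ∷ S) (true  ∷ S') = hamming S S'
  hamming (true  ∷ S) (false ∷ S') = suc (hamming S S')
  hamming (false ∷ S) (true  ∷ S') = suc (hamming S S')
  hamming (false ∷ S) (false ∷ S') = hamming S S'

  hamming-sym : (S S' : Subset n) → hamming S S' ≡ hamming S' S
  hamming-sym [] [] = refl
  hamming-sym (true  ∷ S) (true  ∷ S') = hamming-sym S S'
  hamming-sym (true  ∷ S) (false ∷ S') = cong suc (hamming-sym S S')
  hamming-sym (false ∷ S) (true  ∷ S') = cong suc (hamming-sym S S')
  hamming-sym (false ∷ S) (false ∷ S') = hamming-sym S S'

  hamming-update : (Y Z : Subset n) (i : Fin n) → lookup Y i ≢ lookup Z i →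
                   hamming Y Z ≡ suc (hamming (Y [ i ]≔ lookup Z i) Z)
  hamming-update (true  ∷ Y) (true  ∷ Z) zero h = contradiction refl h
  hamming-update (true  ∷ Y) (false ∷ Z) zero h = refl
  hamming-update (false ∷ Y) (true  ∷ Z) zero h = refl
  hamming-update (false ∷ Y) (false ∷ Z) zero h = contradiction refl h
  hamming-update (true  ∷ Y) (true  ∷ Z) (suc i) h = hamming-update Y Z i h
  hamming-update (true  ∷ Y) (false ∷ Z) (suc i) h = cong suc (hamming-update Y Z i h)
  hamming-update (false ∷ Y) (true  ∷ Z) (suc i) h = cong suc (hamming-update Y Z i h)
  hamming-update (false ∷ Y) (false ∷ Z) (suc i) h = hamming-update Y Z i h

  hamming-swap : (Y Z : Subset n) {i j : Fin n} → i ∈ᵇ Y → i ∉ᵇ Z → j ∈ᵇ Z → j ∉ᵇ Y →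
                 hamming (swap Y i j) Z < hamming Y Z
  hamming-swap Y Z {i} {j} iY iZ jZ jY = begin-strict
    hamming (swap Y i j) Z           <⟨ n<1+n _ ⟩
    suc (hamming (swap Y i j) Z)     ≡⟨ cong (λ b → suc (hamming (M [ j ]≔ b) Z)) jZ ⟨
    suc (hamming (M [ j ]≔ lookup Z j) Z) ≡⟨ hamming-update M Z j
      (λ e → true≢false (trans (trans (sym jZ) (sym e))
          (trans (lookup∘updateAt′ j i (λ e → ∈∉-≢ {S = Y} iY jY (sym e)) Y) jY))) ⟨
    hamming M Z                      <⟨ n<1+n _ ⟩
    suc (hamming M Z)                ≡⟨ cong (λ b → suc (hamming (Y [ i ]≔ b) Z)) iZ ⟨
    suc (hamming (Y [ i ]≔ lookup Z i) Z) ≡⟨ hamming-update Y Z i (λ e → true≢false (trans (sym iY) (trans e iZ))) ⟨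
    hamming Y Z                      ∎
    where
    open ≤-Reasoning
    M = Y [ i ]≔ false

  pickCounts : (A : Subset n) (r s : ℕ) → r ≤ ∣ A ∣ → s ≤ ∣ ∁ A ∣ →
               ∃ λ S → cnt A S ≡ r × cnt (∁ A) S ≡ s
  pickCounts [] zero zero _ _ = [] , refl , refl
  pickCounts (true ∷ A) zero s _ hs with pickCounts A zero s z≤n hs
  ... | S , p , q = false ∷ S , p , q
  pickCounts (true ∷ A) (suc r) s (s≤s hr) hs with pickCounts A r s hr hs
  ... | S , p , q = true ∷ S , cong suc p , q
  pickCounts (false ∷ A) r zero hr _ with pickCounts A r zero hr z≤n
  ... | S , p , q = false ∷ S , p , q
  pickCounts (false ∷ A) r (suc s) hr (s≤s hs) with pickCounts A r s hr hs
  ... | S , p , q = true ∷ S , p , cong suc q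

  -- Any set with the right counts is corrected by at most one exchange inside `A` and one inside
  -- `∁ A`, neither of which changes the counts. `1 ≤ r` supplies an element of `A` to give up for
  -- `p`, and `s < ∣ ∁ A ∣` an element of `∁ A` to take in for `q`.
  pickThrough : (A : Subset n) (r s : ℕ) → 1 ≤ r → r ≤ ∣ A ∣ → s < ∣ ∁ A ∣ → ∀ {p q} → p ∈ᵇ A → q ∉ᵇ A →
                ∃ λ S → cnt A S ≡ r × ∣ S ∣ ≡ r + s × p ∈ᵇ S × q ∉ᵇ S
  pickThrough {n} A r s 1≤r r≤ s< {p} {q} p∈A q∉A = step₂ (step₁ (pickCounts A r s r≤ (<⇒≤ s<)))
    where
    Good : Subset n → Set
    Good S = cnt A S ≡ r × cnt (∁ A) S ≡ s

    same-block : ∀ S {i j} → i ∈ᵇ S → j ∉ᵇ S → lookup A i ≡ lookup A j → Good S → Good (swap S i j)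
    same-block S {i} {j} i∈ j∉ e (g₁ , g₂) = trans (block A e) g₁ , trans
        (block (∁ A) (trans (lookup-map i not A) (trans (cong not e) (sym (lookup-map j not A))))) g₂
      where
      block : ∀ B → lookup B i ≡ lookup B j → cnt B (swap S i j) ≡ cnt B S
      block B e = +-cancelˡ-≡ (bit (lookup B i)) _ _
        (trans (sym (cnt-adj B (swap-adj S i∈ j∉))) (cong (λ b → bit b + cnt B S) (sym e)))

    step₁ : ∃ Good → ∃ λ S → Good S × p ∈ᵇ S
    step₁ (S , g) with ∈-or-∉ S p
    ... | inj₁ p∈S = S , g , p∈S
    -- Compared with the empty set, `excess` returns an element of `S` inside `A`; below, the full
    -- set is used in the same way to find an element of `∁ A` outside `S`.
    ... | inj₂ p∉S with excess A S ⊥ (subst₂ _<_ (sym (trans (cnt-⊥ A) refl)) (sym (proj₁ g)) 1≤r)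
      where
      cnt-⊥ : ∀ {m} (B : Subset m) → cnt B ⊥ ≡ 0
      cnt-⊥ [] = refl
      cnt-⊥ (b ∷ B) = cnt-⊥ B
    ... | i , i∈A , i∈S , _ = swap S i p , same-block S i∈S p∉S (trans i∈A (sym p∈A)) g , swap-in S

    step₂ : (∃ λ S → Good S × p ∈ᵇ S) → ∃ λ S → cnt A S ≡ r × ∣ S ∣ ≡ r + s × p ∈ᵇ S × q ∉ᵇ S
    step₂ (S , g , p∈S) with ∈-or-∉ S q
    ... | inj₂ q∉S = S , proj₁ g , trans (sym (cnt-∁ A S)) (cong₂ _+_ (proj₁ g) (proj₂ g)) , p∈S , q∉S
    ... | inj₁ q∈S with excess (∁ A) ⊤ S (subst₂ _<_ (sym (proj₂ g)) (sym (cnt-⊤ (∁ A))) s<)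
      where
      cnt-⊤ : ∀ {m} (B : Subset m) → cnt B ⊤ ≡ ∣ B ∣
      cnt-⊤ [] = refl
      cnt-⊤ (true ∷ B) = cong suc (cnt-⊤ B)
      cnt-⊤ (false ∷ B) = cnt-⊤ B
    ... | j , j∈∁A , _ , j∉S with same-block S q∈S j∉S (trans q∉A (sym (∈∁ A j∈∁A))) g
    ... | g' = swap S q j , proj₁ g' , trans (sym (cnt-∁ A (swap S q j))) (cong₂ _+_ (proj₁ g') (proj₂ g'))
             , trans (swap-other S (∈∉-≢ {S = A} p∈A q∉A) (∈∉-≢ {S = A} p∈A (∈∁ A j∈∁A))) p∈S
             , swap-out S (∈∉-≢ {S = S} q∈S j∉S)

open Exchanges

-- Rational inequalities and linear functionals on 0/1 points

module Polytopes where
  import Data.Nat as ℕ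
  import Data.Nat.Properties as ℕₚ
  open import Data.Rational using (ℚ; 0ℚ; 1ℚ; ½; _+_; _*_; _-_; -_; _≤_; _<_; nonNegative; positive)
  open import Data.Rational.Properties
  open import Data.Rational.Solver using (module +-*-Solver)
  open +-*-Solver using (solve; _:+_; _:*_; _:-_; _:=_; con)

  p≤q⇒0≤q-p : ∀ {p q} → p ≤ q → 0ℚ ≤ q - p
  p≤q⇒0≤q-p {p} {q} h = subst (_≤ q - p) (+-inverseʳ p) (+-monoˡ-≤ (- p) h)

  0≤q-p⇒p≤q : ∀ {p q} → 0ℚ ≤ q - p → p ≤ q
  0≤q-p⇒p≤q {p} {q} h = subst₂ _≤_ (+-identityˡ p) (solve 2 (λ p q → q :- p :+ p := q) refl p q) (+-monoˡ-≤ p h)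

  q-p≡0⇒p≡q : ∀ {p q} → q - p ≡ 0ℚ → p ≡ q
  q-p≡0⇒p≡q {p} {q} h = trans (sym (+-identityˡ p))
      (trans (cong (_+ p) (sym h)) (solve 2 (λ p q → q :- p :+ p := q) refl p q))

  *-nonneg : ∀ {p q} → 0ℚ ≤ p → 0ℚ ≤ q → 0ℚ ≤ p * q
  *-nonneg {p} {q} hp hq = subst (_≤ p * q) (*-zeroʳ p) (*-monoˡ-≤-nonNeg p {{nonNegative hp}} hq)

  *-pos : ∀ {p q} → 0ℚ < p → 0ℚ < q → 0ℚ < p * q
  *-pos {p} {q} hp hq = subst (_< p * q) (*-zeroʳ p) (*-monoʳ-<-pos p {{positive hp}} hq)

  ≤∧≢⇒< : ∀ {p q : ℚ} → p ≤ q → p ≢ q → p < q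
  ≤∧≢⇒< {p} {q} h ne with <-cmp p q
  ... | tri< a _ _ = a
  ... | tri≈ _ b _ = contradiction b ne
  ... | tri> _ _ c = contradiction (<-≤-trans c h) (<-irrefl refl)

  0<1 : 0ℚ < 1ℚ
  0<1 = positive⁻¹ 1ℚ

  0≤1 : 0ℚ ≤ 1ℚ
  0≤1 = <⇒≤ 0<1

  *-zero-split : ∀ {p q} → 0ℚ ≤ p → 0ℚ ≤ q → p * q ≡ 0ℚ → p ≡ 0ℚ ⊎ q ≡ 0ℚ
  *-zero-split {p} {q} hp hq e with p ≟ 0ℚ | q ≟ 0ℚ
  ... | yes a | _ = inj₁ a
  ... | no _ | yes b = inj₂ b
  ... | no a | no b = contradiction (sym e) (<⇒≢ (*-pos (≤∧≢⇒< hp (a ∘ sym)) (≤∧≢⇒< hq (b ∘ sym))))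

  +-zero-split : ∀ {p q} → 0ℚ ≤ p → 0ℚ ≤ q → p + q ≡ 0ℚ → p ≡ 0ℚ × q ≡ 0ℚ
  +-zero-split {p} {q} hp hq e = ≤-antisym (subst₂ _≤_ (+-identityʳ p) e (+-monoʳ-≤ p hq)) hp
                               , ≤-antisym (subst₂ _≤_ (+-identityˡ q) e (+-monoˡ-≤ q hp)) hq

  ι : ℕ → ℚ
  ι zero    = 0ℚ
  ι (suc m) = 1ℚ + ι m

  0≤ι : ∀ m → 0ℚ ≤ ι m
  0≤ι zero = ≤-refl
  0≤ι (suc m) = +-mono-≤ 0≤1 (0≤ι m)

  ι-mono-≤ : ∀ {l m} → l ℕ.≤ m → ι l ≤ ι m
  ι-mono-≤ {m = m} z≤n = 0≤ι m
  ι-mono-≤ (s≤s h) = +-monoʳ-≤ 1ℚ (ι-mono-≤ h)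

  ι-mono-< : ∀ {l m} → l ℕ.< m → ι l < ι m
  ι-mono-< {l} h = <-≤-trans (subst (_< ι (suc l)) (+-identityˡ (ι l)) (+-monoˡ-< (ι l) 0<1)) (ι-mono-≤ h)

  ι-cancel-≤ : ∀ {l m} → ι l ≤ ι m → l ℕ.≤ m
  ι-cancel-≤ {l} {m} h with l ℕₚ.≤? m
  ... | yes p = p
  ... | no p = contradiction (<-≤-trans (ι-mono-< (ℕₚ.≰⇒> p)) h) (<-irrefl refl)

  ι-injective : ∀ {l m} → ι l ≡ ι m → l ≡ m
  ι-injective e = ℕₚ.≤-antisym (ι-cancel-≤ (≤-reflexive e)) (ι-cancel-≤ (≤-reflexive (sym e)))

  dot-cong : (a : Point n) {x y : Point n} → (∀ i → x i ≡ y i) → dot a x ≡ dot a y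
  dot-cong {zero}  a h = refl
  dot-cong {suc n} a h = cong₂ _+_ (cong (a zero *_) (h zero)) (dot-cong (a ∘ suc) (h ∘ suc))

  dot-0 : (a : Point n) → dot a (λ _ → 0ℚ) ≡ 0ℚ
  dot-0 {zero}  a = refl
  dot-0 {suc n} a = trans (cong₂ _+_ (*-zeroʳ (a zero)) (dot-0 (a ∘ suc))) (+-identityʳ 0ℚ)

  dot-linear : (a : Point n) (w : ℚ) (x y : Point n) → dot a (λ i → w * x i + y i) ≡ w * dot a x + dot a y
  dot-linear {zero}  a w x y = trans (sym (*-zeroʳ w)) (sym (+-identityʳ _))
  dot-linear {suc n} a w x y =
    trans (cong (a zero * (w * x zero + y zero) +_) (dot-linear (a ∘ suc) w (x ∘ suc) (y ∘ suc)))
      (solve 6 (λ a w x y d e → a :* (w :* x :+ y) :+ (w :* d :+ e) := w :* (a :* x :+ d) :+ (a :* y :+ e)) refl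
        (a zero) w (x zero) (y zero) (dot (a ∘ suc) (x ∘ suc)) (dot (a ∘ suc) (y ∘ suc)))

  value : Point n → Subset n → ℚ
  value a S = dot a (indicator S)

  indicator-∈ : (S : Subset n) {i : Fin n} → i ∈ᵇ S → indicator S i ≡ 1ℚ
  indicator-∈ S e rewrite e = refl

  indicator-∉ : (S : Subset n) {i : Fin n} → i ∉ᵇ S → indicator S i ≡ 0ℚ
  indicator-∉ S e rewrite e = refl

  indicator≡0 : (S : Subset n) {i : Fin n} → indicator S i ≡ 0ℚ → i ∉ᵇ S
  indicator≡0 S {i} e with lookup S i
  ... | false = refl
  ... | true = contradiction e (λ ())

  indicator≢0 : (S : Subset n) {i : Fin n} → indicator S i ≢ 0ℚ → i ∈ᵇ S
  indicator≢0 S {i} e with lookup S i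
  ... | true = refl
  ... | false = contradiction refl e

  0≤indicator : (S : Subset n) (i : Fin n) → 0ℚ ≤ indicator S i
  0≤indicator S i with lookup S i
  ... | true = 0≤1
  ... | false = ≤-refl

  indicator≤1 : (S : Subset n) (i : Fin n) → indicator S i ≤ 1ℚ
  indicator≤1 S i with lookup S i
  ... | true = ≤-refl
  ... | false = 0≤1

  value-off : (a : Point n) (S S' : Subset n) {i : Fin n} → Off S S' i → value a S ≡ a i + value a S'
  value-off a (x ∷ S) (y ∷ S') {zero} o with Off.i∈ o | Off.i∉ o | off-head o
  ... | refl | refl | refl = solve 2 (λ a v → a :* con 1ℚ :+ v := a :+ (a :* con 0ℚ :+ v)) refl (a zero)
      (value (a ∘ suc) S)
  value-off a (x ∷ S) (y ∷ S') {suc i} o with off-tail o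
  ... | refl , o' = trans (cong (a zero * indicator (x ∷ S) zero +_) (value-off (a ∘ suc) S S' o'))
     (solve 3 (λ t a v → t :+ (a :+ v) := a :+ (t :+ v)) refl (a zero * indicator (x ∷ S) zero) (a (suc i))
         (value (a ∘ suc) S'))

  value-adj : (a : Point n) {S S' : Subset n} {i j : Fin n} → Adj S S' i j → a j + value a S ≡ a i + value a S'
  value-adj a {S} {S'} {i} {j} e with adj-middle e
  ... | M , o , o' = begin
    a j + value a S         ≡⟨ cong (a j +_) (value-off a S M o) ⟩
    a j + (a i + value a M) ≡⟨ solve 3 (λ x y z → x :+ (y :+ z) := y :+ (x :+ z)) refl (a j) (a i) (value a M) ⟩
    a i + (a j + value a M) ≡⟨ cong (a i +_) (value-off a S' M o') ⟨
    a i + value a S'        ∎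
    where open ≡-Reasoning

  value-indicator : (A S : Subset n) → value (indicator A) S ≡ ι (cnt A S)
  value-indicator [] [] = refl
  value-indicator (a ∷ A) (false ∷ S) =
    trans (cong₂ _+_ (*-zeroʳ (indicator (a ∷ A) zero)) (value-indicator A S)) (+-identityˡ _)
  value-indicator (true ∷ A) (true ∷ S) = cong (1ℚ +_) (value-indicator A S)
  value-indicator (false ∷ A) (true ∷ S) = trans (cong (0ℚ * 1ℚ +_) (value-indicator A S)) (+-identityˡ _)

  -- Weighted lists of vertices and the points they represent

  WList : ℕ → Set
  WList n = List (ℚ × Subset n)

  Weighted : (Subset n → Set) → ℚ × Subset n → Set
  Weighted P (w , A) = (0ℚ ≤ w) × P A

  expect : (Subset n → ℚ) → WList n → ℚ
  expect f []             = 0ℚ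
  expect f ((w , A) ∷ ws) = w * f A + expect f ws

  wsum-expect : (ws : WList n) (i : Fin n) → wsum ws i ≡ expect (λ A → indicator A i) ws
  wsum-expect [] i = refl
  wsum-expect ((w , A) ∷ ws) i = cong (w * indicator A i +_) (wsum-expect ws i)

  dot-wsum : (a : Point n) (ws : WList n) → dot a (wsum ws) ≡ expect (value a) ws
  dot-wsum a [] = dot-0 a
  dot-wsum a ((w , A) ∷ ws) = trans (dot-linear a w (indicator A) (wsum ws))
      (cong (w * value a A +_) (dot-wsum a ws))

  expect-sub : (c : ℚ) (f : Subset n → ℚ) (ws : WList n) →
               expect (λ A → c - f A) ws ≡ c * wtotal ws - expect f ws
  expect-sub c f [] = sym (trans (+-identityʳ _) (*-zeroʳ c))
  expect-sub c f ((w , A) ∷ ws) = trans (cong (w * (c - f A) +_) (expect-sub c f ws))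
    (solve 5 (λ c w a t e → w :* (c :- a) :+ (c :* t :- e) := c :* (w :+ t) :- (w :* a :+ e)) refl
      c w (f A) (wtotal ws) (expect f ws))

  expect-nonneg : (f : Subset n → ℚ) {ws : WList n} → All (Weighted λ A → 0ℚ ≤ f A) ws → 0ℚ ≤ expect f ws
  expect-nonneg f [] = ≤-refl
  expect-nonneg f ((p , q) ∷ h) = +-mono-≤ (*-nonneg p q) (expect-nonneg f h)

  -- A list may carry items of weight 0, and extremality says nothing about their subsets.
  Vanishes : (Subset n → Set) → ℚ × Subset n → Set
  Vanishes P (w , A) = w ≡ 0ℚ ⊎ P A

  expect-zero : (f : Subset n → ℚ) {ws : WList n} → All (Weighted λ A → 0ℚ ≤ f A) ws → expect f ws ≡ 0ℚ →
                All (Vanishes λ A → f A ≡ 0ℚ) ws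
  expect-zero f [] e = []
  expect-zero f ((p , q) ∷ h) e with +-zero-split (*-nonneg p q) (expect-nonneg f h) e
  ... | e₁ , e₂ = *-zero-split p q e₁ ∷ expect-zero f h e₂

  module _ (f : Subset n → ℚ) {b : ℚ} {ws : WList n} (h : All (Weighted λ A → f A ≤ b) ws)
      (total : wtotal ws ≡ 1ℚ) where
    private
      gap : All (Weighted λ A → 0ℚ ≤ b - f A) ws
      gap = All.map (λ { (p , q) → p , p≤q⇒0≤q-p q }) h

      -- Total weight 1 makes `b` its own average, so both results below are the nonnegative case
      -- applied to the slack `b - f A`.
      expect-gap : expect (λ A → b - f A) ws ≡ b - expect f ws
      expect-gap = trans (expect-sub b f ws) (cong (_- expect f ws) (trans (cong (b *_) total) (*-identityʳ b)))

    expect-≤ : expect f ws ≤ b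
    expect-≤ = 0≤q-p⇒p≤q (subst (0ℚ ≤_) expect-gap (expect-nonneg _ gap))

    expect-tight : expect f ws ≡ b → All (Vanishes λ A → f A ≡ b) ws
    expect-tight e = All.map (λ { (inj₁ z) → inj₁ z ; (inj₂ z) → inj₂ (q-p≡0⇒p≡q z) })
      (expect-zero _ gap (trans expect-gap (trans (cong (λ t → b - t) e) (+-inverseʳ b))))

  positive-member : (f : Subset n → ℚ) (ws : WList n) → 0ℚ < expect f ws →
                    ∃₂ λ w A → (w , A) ∈ ws × w ≢ 0ℚ × f A ≢ 0ℚ
  positive-member f [] h = contradiction h (<-irrefl refl)
  positive-member f ((w , A) ∷ ws) h with w ≟ 0ℚ | f A ≟ 0ℚ
  ... | no p | no q = w , A , here refl , p , q
  ... | yes refl | _ with positive-member f ws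
      (subst (0ℚ <_) (trans (cong (_+ expect f ws) (*-zeroˡ (f A))) (+-identityˡ _)) h)
  ...   | w' , A' , m , p = w' , A' , there m , p
  positive-member f ((w , A) ∷ ws) h | no _ | yes e with positive-member f ws (subst (0ℚ <_)
         (trans (cong (_+ expect f ws) (trans (cong (w *_) e) (*-zeroʳ w))) (+-identityˡ _)) h)
  ...   | w' , A' , m , p = w' , A' , there m , p

  vanishes-at : ∀ {P : Subset n → Set} {ws : WList n} {w A} → All (Vanishes P) ws → (w , A) ∈ ws → w ≢ 0ℚ → P A
  vanishes-at h m w≢0 with All.lookup h m
  ... | inj₁ e = contradiction e w≢0
  ... | inj₂ p = p

  -- The coordinate values 0 and 1 are extremal, so every vertex of positive weight attains them.
  support : ∀ {P : Subset n → Set} {x : Point n} {i} → conv P x → 0ℚ < x i →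
            ∃ λ A → P A × i ∈ᵇ A × (∀ p → (x p ≡ 0ℚ → p ∉ᵇ A) × (x p ≡ 1ℚ → p ∈ᵇ A))
  support {n} {P} {x} {i} (ws , pos , total , eqs) 0<xi
    with positive-member (λ A → indicator A i) ws (subst (0ℚ <_) (trans (sym (eqs i)) (wsum-expect ws i)) 0<xi)
  ... | w , A , m , w≢0 , i∈ = A , proj₂ (All.lookup pos m) , indicator≢0 A i∈ , λ p → is0 p , is1 p
    where
    exp : ∀ p → expect (λ A → indicator A p) ws ≡ x p
    exp p = trans (sym (wsum-expect ws p)) (eqs p)
    is0 : ∀ p → x p ≡ 0ℚ → p ∉ᵇ A
    is0 p e = indicator≡0 A (vanishes-at
      (expect-zero (λ A → indicator A p) (All.map (λ {wA} h → proj₁ h , 0≤indicator (proj₂ wA) p) pos)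
          (trans (exp p) e)) m w≢0)
    is1 : ∀ p → x p ≡ 1ℚ → p ∈ᵇ A
    is1 p e = indicator≢0 A (λ z → contradiction (trans (sym z) (vanishes-at
      (expect-tight (λ A → indicator A p)
          (All.map (λ {wA} h → proj₁ h , indicator≤1 (proj₂ wA) p) pos) total (trans (exp p) e)) m w≢0)) (λ ()))

  conv-≤ : ∀ {P : Subset n → Set} (a : Point n) {b} → (∀ A → P A → value a A ≤ b) → ∀ {x} → conv P x → dot a x ≤ b
  conv-≤ a {b} h (ws , pos , total , eqs) =
    subst (_≤ b) (trans (sym (dot-wsum a ws)) (dot-cong a eqs))
      (expect-≤ (value a) (All.map (λ {wA} p → proj₁ p , h (proj₂ wA) (proj₂ p)) pos) total)

  -- Dropping the items of weight 0 leaves a combination of the vertices of the face.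
  conv-tight : ∀ {P : Subset n → Set} (a : Point n) {b} → (∀ A → P A → value a A ≤ b) → ∀ {x} → conv P x →
      dot a x ≡ b →
               conv (λ A → P A × value a A ≡ b) x
  conv-tight {n} {P} a {b} h (ws , pos , total , eqs) e =
    let vs , pos' , t , s = drop0 ws pos tight
    in vs , pos' , trans t total , λ i → trans (s i) (eqs i)
    where
    tight : All (Vanishes λ A → value a A ≡ b) ws
    tight = expect-tight (value a) (All.map (λ {wA} p → proj₁ p , h (proj₂ wA) (proj₂ p)) pos) total
              (trans (sym (dot-wsum a ws)) (trans (dot-cong a eqs) e))
    drop0 : ∀ {Q : Subset n → Set} (ws : WList n) → All (Weighted P) ws → All (Vanishes Q) ws →
            ∃ λ vs → All (Weighted λ A → P A × Q A) vs × wtotal vs ≡ wtotal ws × (∀ i → wsum vs i ≡ wsum ws i)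
    drop0 [] _ _ = [] , [] , refl , λ _ → refl
    drop0 ((w , A) ∷ ws) ((p , q) ∷ ps) (z ∷ zs) with drop0 ws ps zs
    ... | vs , h , t , s with z
    ... | inj₁ refl = vs , h , trans t (sym (+-identityˡ _)) ,
            λ i → trans (s i) (sym (trans (cong (_+ wsum ws i) (*-zeroˡ (indicator A i))) (+-identityˡ _)))
    ... | inj₂ r = (w , A) ∷ vs , (p , q , r) ∷ h , cong (w +_) t , λ i → cong (w * indicator A i +_) (s i)

  conv-mono : ∀ {P Q : Subset n → Set} → (∀ A → P A → Q A) → ∀ {x} → conv P x → conv Q x
  conv-mono f (ws , pos , rest) = ws , All.map (λ {wA} p → proj₁ p , f (proj₂ wA) (proj₂ p)) pos , rest

  vertex : ∀ {P : Subset n} {Q : Subset n → Set} → Q P → conv Q (indicator P)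
  vertex {P = P} q = (1ℚ , P) ∷ [] , (0≤1 , q) ∷ [] , refl ,
    λ i → trans (+-identityʳ _) (*-identityˡ (indicator P i))

  midpoint : (S S' : Subset n) → Point n
  midpoint S S' i = ½ * indicator S i + ½ * indicator S' i

  midpoint-conv : ∀ {S S' : Subset n} {Q : Subset n → Set} → Q S → Q S' → conv Q (midpoint S S')
  midpoint-conv {S = S} {S'} q q' = (½ , S) ∷ (½ , S') ∷ [] , (0≤½ , q) ∷ (0≤½ , q') ∷ [] , refl ,
    λ i → cong (½ * indicator S i +_) (+-identityʳ _)
    where
    0≤½ : 0ℚ ≤ ½
    0≤½ = nonNegative⁻¹ ½

  -- Moving a convex combination to one side of a hyperplane

  Balanced : (S S' U U' : Subset n) → Set
  Balanced S S' U U' = ∀ p → indicator S p + indicator S' p ≡ indicator U p + indicator U' p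

  -- What one set loses the other gains, so the midpoint of the pair is unchanged, and at equal
  -- weights the new pair can replace the old one.
  swap-balanced : (S S' : Subset n) {i j : Fin n} → i ∈ᵇ S → i ∉ᵇ S' → j ∈ᵇ S' → j ∉ᵇ S →
                  Balanced S S' (swap S i j) (swap S' j i)
  swap-balanced S S' {i} {j} iS iS' jS' jS p with p Fin.≟ i | p Fin.≟ j
  ... | yes refl | _ = trans (cong₂ _+_ (indicator-∈ S iS) (indicator-∉ S' iS'))
        (sym (cong₂ _+_ (indicator-∉ (swap S i j) (swap-out S (∈∉-≢ {S = S} iS jS)))
            (indicator-∈ (swap S' j i) (swap-in S'))))
  ... | no _ | yes refl = trans (cong₂ _+_ (indicator-∉ S jS) (indicator-∈ S' jS'))
        (sym (cong₂ _+_ (indicator-∈ (swap S i j) (swap-in S))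
            (indicator-∉ (swap S' j i) (swap-out S' (∈∉-≢ {S = S'} jS' iS')))))
  ... | no a | no b = sym (cong₂ _+_ (cong (λ t → if t then 1ℚ else 0ℚ) (swap-other S a b))
                                     (cong (λ t → if t then 1ℚ else 0ℚ) (swap-other S' b a)))

  record _≋_ (ws vs : WList n) : Set where
    constructor mk≋
    field
      total≡ : wtotal ws ≡ wtotal vs
      sum≡   : ∀ i → wsum ws i ≡ wsum vs i

  ≋-refl : {ws : WList n} → ws ≋ ws
  ≋-refl = mk≋ refl (λ _ → refl)

  ≋-trans : {us vs ws : WList n} → us ≋ vs → vs ≋ ws → us ≋ ws
  ≋-trans (mk≋ a b) (mk≋ c d) = mk≋ (trans a c) (λ i → trans (b i) (d i))

  ≋-cons : ∀ {w} {S : Subset n} {us vs} → us ≋ vs → ((w , S) ∷ us) ≋ ((w , S) ∷ vs)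
  ≋-cons {w = w} {S} (mk≋ a b) = mk≋ (cong (w +_) a) (λ i → cong (w * indicator S i +_) (b i))

  ≋-swap : ∀ {w v} {S T : Subset n} {us} → ((w , S) ∷ (v , T) ∷ us) ≋ ((v , T) ∷ (w , S) ∷ us)
  ≋-swap {w = w} {v} {S} {T} {us} = mk≋
    (x∙yz≈y∙xz w v (wtotal us))
    (λ i → x∙yz≈y∙xz (w * indicator S i) (v * indicator T i) (wsum us i))
    where
    x∙yz≈y∙xz : ∀ x y z → x + (y + z) ≡ y + (x + z)
    x∙yz≈y∙xz = solve 3 (λ x y z → x :+ (y :+ z) := y :+ (x :+ z)) refl

  -- Only the weight `w` is traded and `w' - w` stays on `S'`; this is meant for `w ≤ w'`, where the
  -- remainder is nonnegative.
  exchange-≤ : ∀ {w w'} {S S' U U' : Subset n} {ws} → Balanced S S' U U' →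
               ((w , U) ∷ (w , U') ∷ (w' - w , S') ∷ ws) ≋ ((w , S) ∷ (w' , S') ∷ ws)
  exchange-≤ {w = w} {w'} {S} {S'} {U} {U'} {ws} bal = mk≋
    (solve 3 (λ w w' t → w :+ (w :+ (w' :- w :+ t)) := w :+ (w' :+ t)) refl w w' (wtotal ws))
    λ p → trans (solve 6 (λ w w' u u' s' t → w :* u :+ (w :* u' :+ ((w' :- w) :* s' :+ t))
        := w :* (u :+ u') :+ ((w' :- w) :* s' :+ t)) refl
                    w w' (indicator U p) (indicator U' p) (indicator S' p) (wsum ws p))
           (trans (cong (λ z → w * z + ((w' - w) * indicator S' p + wsum ws p)) (sym (bal p)))
                  (solve 5 (λ w w' s s' t → w :* (s :+ s') :+ ((w' :- w) :* s' :+ t)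
                      := w :* s :+ (w' :* s' :+ t)) refl
                    w w' (indicator S p) (indicator S' p) (wsum ws p)))

  -- The mirror case leaves `w - w'` on `S`, which is still on the wrong side. `vs` stands for the
  -- list after this remainder has been worked into `ws`.
  exchange-≥ : ∀ {w w'} {S S' U U' : Subset n} {ws vs} → Balanced S S' U U' → vs ≋ ((w - w' , S) ∷ ws) →
               ((w' , U) ∷ (w' , U') ∷ vs) ≋ ((w , S) ∷ (w' , S') ∷ ws)
  exchange-≥ {w = w} {w'} {S} {S'} {U} {U'} {ws} {vs} bal (mk≋ a b) = mk≋
    (trans (cong (λ t → w' + (w' + t)) a)
        (solve 3 (λ w w' t → w' :+ (w' :+ (w :- w' :+ t)) := w :+ (w' :+ t)) refl w w' (wtotal ws)))
    λ p → trans (cong (λ t → w' * indicator U p + (w' * indicator U' p + t)) (b p))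
           (trans (solve 6 (λ w w' u u' s t → w' :* u :+ (w' :* u' :+ ((w :- w') :* s :+ t))
               := w' :* (u :+ u') :+ ((w :- w') :* s :+ t)) refl
                    w w' (indicator U p) (indicator U' p) (indicator S p) (wsum ws p))
           (trans (cong (λ z → w' * z + ((w - w') * indicator S p + wsum ws p)) (sym (bal p)))
                  (solve 5 (λ w w' s s' t → w' :* (s :+ s') :+ ((w :- w') :* s :+ t)
                      := w :* s :+ (w' :* s' :+ t)) refl
                    w w' (indicator S p) (indicator S' p) (wsum ws p))))

  -- `up` and `dn` measure how far a vertex lies strictly above resp. below a hyperplane. If a vertex
  -- above and one below can be exchanged for two vertices one step closer, then every nonnegative combination
  -- can be rewritten as one whose vertices all lie weakly on the same side.
  module Rounding {n : ℕ} (K : Subset n → Set) where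

    ≤-by : ∀ {a b c : ℕ} → a ≡ b → b ℕ.≤ c → a ℕ.≤ c
    ≤-by refl h = h

    zero-or-suc : ∀ m → m ≡ 0 ⊎ ∃ λ c → m ≡ suc c
    zero-or-suc zero = inj₁ refl
    zero-or-suc (suc m) = inj₂ (m , refl)

    Exchange : (up dn : Subset n → ℕ) → Set
    Exchange up dn = ∀ S S' {u d} → K S → K S' → up S ≡ suc u → dn S' ≡ suc d →
      ∃₂ λ U U' → K U × K U' × Balanced S S' U U' × (up U ≡ u × dn U ≡ 0) × (dn U' ≡ d × up U' ≡ 0)

    flip-exchange : ∀ {up dn} → Exchange up dn → Exchange dn up
    flip-exchange ex S S' kS kS' e e' with ex S' S kS' kS e' e
    ... | U , U' , kU , kU' , bal , p , q = U' , U , kU' , kU ,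
          (λ x → trans (+-comm (indicator S x) (indicator S' x))
              (trans (bal x) (+-comm (indicator U x) (indicator U' x)))) , q , p

    Below : (up dn : Subset n → ℕ) → ℕ → Subset n → Set
    Below up dn d S = K S × up S ≡ 0 × dn S ℕ.≤ d

    Rounded : (up dn : Subset n → ℕ) (p d : ℕ) → WList n → Set
    Rounded up dn p d ws = ∃ λ vs → vs ≋ ws ×
        (All (Weighted (Below up dn d)) vs ⊎ All (Weighted (Below dn up p)) vs)

    below-mono : ∀ {up dn d d'} → d ℕ.≤ d' → ∀ {ws} → All (Weighted (Below up dn d)) ws →
        All (Weighted (Below up dn d')) ws
    below-mono le = All.map (λ { (a , k , u , d) → a , k , u , ℕₚ.≤-trans d le })

    -- A vertex at height at most `p` meets a list reaching down to depth at most `d`. The induction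
    -- is on the bound `N` for `p + d`, and for fixed `N` on the list.
    Insertion : ℕ → Set
    Insertion N = ∀ {up dn} → Exchange up dn → ∀ p d → p ℕ.+ d ℕ.≤ N → ∀ {w S} → 0ℚ ≤ w → Below dn up p S →
                  ∀ ws → All (Weighted (Below up dn d)) ws → Rounded up dn p d ((w , S) ∷ ws)

    insert-level : ∀ {up dn p d w S} → 0ℚ ≤ w → Below dn up p S → up S ≡ 0 →
                   ∀ ws → All (Weighted (Below up dn d)) ws → Rounded up dn p d ((w , S) ∷ ws)
    insert-level {w = w} {S} hw (kS , dnS , _) eS ws hws =
      (w , S) ∷ ws , ≋-refl , inj₁ ((hw , kS , eS , ≤-by dnS z≤n) ∷ hws)

    insert-step : ∀ N → Insertion N → Insertion (suc N)
    insert-step N ih {up} ex p d le {S = S} hw b ws hws with zero-or-suc (up S)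
    insert-step N ih ex p d le hw b ws hws | inj₁ eS = insert-level hw b eS ws hws
    insert-step N ih ex p d le {w} {S} hw b [] [] | inj₂ _ = (w , S) ∷ [] , ≋-refl , inj₂ ((hw , b) ∷ [])
    insert-step N ih {up} {dn} ex p d le hw b ((w' , S') ∷ ws) ((hw' , kS' , upS' , dnS') ∷ hws) |
        inj₂ (u , eS) with zero-or-suc (dn S')
    -- `S'` lies on the hyperplane and therefore fits either outcome.
    ... | inj₁ eS' =
      let vs , eq , side = insert-step N ih ex p d le hw b ws hws
      in (w' , S') ∷ vs , ≋-trans (≋-cons eq) ≋-swap ,
         Sum.map ((hw' , kS' , upS' , ≤-by eS' z≤n) ∷_) ((hw' , kS' , eS' , ≤-by upS' z≤n) ∷_) side
    insert-step N ih ex zero d le hw (_ , _ , upS) (_ ∷ _) (_ ∷ _) | inj₂ (u , eS) | inj₂ _ =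
      contradiction (subst (ℕ._≤ 0) eS upS) λ ()
    insert-step N ih ex (suc p) zero le hw b (_ ∷ _) ((_ , _ , _ , dnS') ∷ _) | inj₂ _ | inj₂ (e , eS') =
      contradiction (subst (ℕ._≤ 0) eS' dnS') λ ()
    insert-step N ih {up} {dn} ex (suc p) (suc d) (s≤s le) {w} {S} hw b@(kS , dnS , upS)
        ((w' , S') ∷ ws) ((hw' , b'@(kS' , upS' , dnS')) ∷ hws)
      | inj₂ (u , eS) | inj₂ (e , eS') with ex S S' kS kS' eS eS' | ≤-total w w'
    -- All of the weight of `S` is traded. It remains to insert `U`, which is one step lower than
    -- `S`, so `p` drops.
    ... | U , U' , kU , kU' , bal , (upU , dnU) , (dnU' , upU') | inj₁ w≤w' =
      let u≤p = ℕₚ.≤-pred (subst (ℕ._≤ suc p) eS upS)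
          e≤d = ℕₚ.≤-pred (subst (ℕ._≤ suc d) eS' dnS')
          vs , eq , side = ih ex p (suc d) le hw (kU , dnU , ≤-by upU u≤p) ((w , U') ∷ (w' - w , S') ∷ ws)
            ((hw , kU' , upU' , ≤-by dnU' (ℕₚ.m≤n⇒m≤1+n e≤d)) ∷ (p≤q⇒0≤q-p w≤w' , kS' , upS' , dnS') ∷ hws)
      in vs , ≋-trans eq (exchange-≤ bal) , Sum.map₂ (below-mono (ℕₚ.n≤1+n p)) side
    -- Part of `S` is left over; it is inserted into the shorter list before the traded pair is
    -- added.
    ... | U , U' , kU , kU' , bal , (upU , dnU) , (dnU' , upU') | inj₂ w'≤w
        with insert-step N ih ex (suc p) (suc d) (s≤s le) (p≤q⇒0≤q-p w'≤w) b ws hws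
    ...   | vs , eq , inj₁ lo =
      let u≤p = ℕₚ.≤-pred (subst (ℕ._≤ suc p) eS upS)
          e≤d = ℕₚ.≤-pred (subst (ℕ._≤ suc d) eS' dnS')
          us , eq' , side = ih ex p (suc d) le hw' (kU , dnU , ≤-by upU u≤p)
            ((w' , U') ∷ vs) ((hw' , kU' , upU' , ≤-by dnU' (ℕₚ.m≤n⇒m≤1+n e≤d)) ∷ lo)
      in us , ≋-trans eq' (exchange-≥ bal eq) , Sum.map₂ (below-mono (ℕₚ.n≤1+n p)) side
    -- The rest has ended up above the hyperplane, so now `U'` is the odd one out. It is inserted
    -- with `up` and `dn` interchanged, and its depth `d` in place of `suc d` pays for the call.
    ...   | vs , eq , inj₂ hi =
      let u≤p = ℕₚ.≤-pred (subst (ℕ._≤ suc p) eS upS)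
          e≤d = ℕₚ.≤-pred (subst (ℕ._≤ suc d) eS' dnS')
          us , eq' , side = ih (flip-exchange {up} {dn} ex) d (suc p)
            (≤-by (trans (ℕₚ.+-suc d p) (trans (cong suc (ℕₚ.+-comm d p)) (sym (ℕₚ.+-suc p d)))) le)
            hw' (kU' , upU' , ≤-by dnU' e≤d)
            ((w' , U) ∷ vs) ((hw' , kU , dnU , ≤-by upU (ℕₚ.m≤n⇒m≤1+n u≤p)) ∷ hi)
      in us , ≋-trans eq' (≋-trans ≋-swap (exchange-≥ bal eq)) , Sum.map₁ (below-mono (ℕₚ.n≤1+n d)) (Sum.swap side)

    insert : ∀ N → Insertion N
    insert zero ex zero zero le hw b ws hws = insert-level hw b (ℕₚ.n≤0⇒n≡0 (proj₂ (proj₂ b))) ws hws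
    insert (suc N) = insert-step N (insert N)

    round : ∀ {up dn} → Exchange up dn → ∀ M → (∀ S → K S → Below up dn M S ⊎ Below dn up M S) →
            ∀ ws → All (Weighted K) ws → Rounded up dn M M ws
    round ex M side [] [] = [] , ≋-refl , inj₁ []
    round {up} {dn} ex M side ((w , S) ∷ ws) ((hw , kS) ∷ h) with round ex M side ws h | side S kS
    ... | vs , eq , inj₁ lo | inj₁ b = (w , S) ∷ vs , ≋-cons eq , inj₁ ((hw , b) ∷ lo)
    ... | vs , eq , inj₂ hi | inj₂ b = (w , S) ∷ vs , ≋-cons eq , inj₂ ((hw , b) ∷ hi)
    ... | vs , eq , inj₁ lo | inj₂ b with insert (M ℕ.+ M) ex M M ℕₚ.≤-refl hw b vs lo
    ...   | us , eq' , s = us , ≋-trans eq' (≋-cons eq) , s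
    round {up} {dn} ex M side ((w , S) ∷ ws) ((hw , kS) ∷ h)
        | vs , eq , inj₂ hi | inj₁ b with insert (M ℕ.+ M) (flip-exchange {up} {dn} ex) M M ℕₚ.≤-refl hw b vs hi
    ...   | us , eq' , s = us , ≋-trans eq' (≋-cons eq) , Sum.swap s

  module _ {n : ℕ} (k j : ℕ) (A : Subset n) where
    private
      K : Subset n → Set
      K S = ∣ S ∣ ≡ k
      up dn : Subset n → ℕ
      up S = cnt A S ∸ j
      dn S = j ∸ cnt A S
      open Rounding K

      ∸-suc : ∀ a b {c} → a ∸ b ≡ suc c → b ℕ.< a
      ∸-suc a b e = ℕₚ.m∸n≢0⇒n<m (λ z → contradiction (trans (sym e) z) (λ ()))

      -- `S` has more of `A` than `S'`, so by equal cardinality `S'` has more of `∁ A`; this yields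
      -- `i` and `l`. Both counts are off by at least one, so a single step never overshoots `j`.
      exchange : Exchange up dn
      exchange S S' {u} {d} kS kS' eu ed =
        let j<S = ∸-suc (cnt A S) j eu
            S'<j = ∸-suc j (cnt A S') ed
            S'<S = ℕₚ.<-trans S'<j j<S
            i , iA , iS , iS' = excess A S S' S'<S
            l , l∁A , lS' , lS = excess (∁ A) S' S (ℕₚ.+-cancelˡ-< (cnt A S') _ _ (ℕₚ.<-≤-trans
              (ℕₚ.+-monoˡ-< (cnt (∁ A) S) S'<S)
                  (ℕₚ.≤-reflexive (trans (trans (cnt-∁ A S) (trans kS (sym kS'))) (sym (cnt-∁ A S'))))))
            e₁ = swap-adj S iS lS
            e₂ = swap-adj S' lS' iS'
            down : cnt A S ≡ suc (cnt A (swap S i l))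
            down = subst₂ (λ a b → bit a ℕ.+ cnt A S ≡ bit b ℕ.+ cnt A (swap S i l)) (∈∁ A l∁A) iA (cnt-adj A e₁)
            rise : suc (cnt A S') ≡ cnt A (swap S' l i)
            rise = subst₂ (λ a b → bit a ℕ.+ cnt A S' ≡ bit b ℕ.+ cnt A (swap S' l i)) iA (∈∁ A l∁A) (cnt-adj A e₂)
            j≤U = ℕₚ.≤-pred (subst (j ℕ.<_) down j<S)
            U'≤j = subst (ℕ._≤ j) rise S'<j
        in swap S i l , swap S' l i , trans (card-adj e₁) kS , trans (card-adj e₂) kS' ,
               swap-balanced S S' iS iS' lS' lS
         , (ℕₚ.suc-injective (trans (sym (ℕₚ.+-∸-assoc 1 j≤U)) (trans (cong (_∸ j) (sym down)) eu)) ,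
             ℕₚ.m≤n⇒m∸n≡0 j≤U)
         , (ℕₚ.suc-injective (trans (sym (ℕₚ.+-∸-assoc 1 U'≤j)) (trans (cong (suc j ∸_) (sym rise)) ed)) ,
             ℕₚ.m≤n⇒m∸n≡0 U'≤j)

      side : ∀ S → K S → Below up dn (k ℕ.+ j) S ⊎ Below dn up (k ℕ.+ j) S
      side S kS with ℕₚ.≤-total (cnt A S) j
      ... | inj₁ h = inj₁ (kS , ℕₚ.m≤n⇒m∸n≡0 h , ℕₚ.≤-trans (ℕₚ.m∸n≤m j (cnt A S)) (ℕₚ.m≤n+m j k))
      ... | inj₂ h = inj₂ (kS , ℕₚ.m≤n⇒m∸n≡0 h ,
               ℕₚ.≤-trans (ℕₚ.m∸n≤m (cnt A S) j) (ℕₚ.≤-trans (subst (cnt A S ℕ.≤_) kS (cnt≤ A S)) (ℕₚ.m≤m+n k j)))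

      conv-≋ : ∀ {P Q : Subset n → Set} → (∀ S → P S → Q S) → ∀ {ws vs x} → vs ≋ ws → All (Weighted P) vs →
               wtotal ws ≡ 1ℚ → (∀ i → wsum ws i ≡ x i) → conv Q x
      conv-≋ f {vs = vs} (mk≋ t s) h total eqs =
        vs , All.map (λ {wS} p → proj₁ p , f (proj₂ wS) (proj₂ p)) h , trans t total , λ i → trans (s i) (eqs i)

    hypersimplex-cover : ∀ x → Hypersimplex k n x →
      conv (λ S → ∣ S ∣ ≡ k × cnt A S ℕ.≤ j) x ⊎ conv (λ S → ∣ S ∣ ≡ k × j ℕ.≤ cnt A S) x
    hypersimplex-cover x (ws , pos , total , eqs) =
      let vs , eq , d = round {up} {dn} exchange (k ℕ.+ j) side ws pos
      in Sum.map (λ h → conv-≋ (λ S b → proj₁ b , ℕₚ.m∸n≡0⇒m≤n (proj₁ (proj₂ b))) eq h total eqs)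
                 (λ h → conv-≋ (λ S b → proj₁ b , ℕₚ.m∸n≡0⇒m≤n (proj₁ (proj₂ b))) eq h total eqs) d

  -- Every admissible hyperplane gives a split

  tableOf : (Subset n → Bool) → Table n
  tableOf {zero}  f = f []
  tableOf {suc n} f = tableOf (f ∘ (false ∷_)) , tableOf (f ∘ (true ∷_))

  ∈-tableOf⁺ : (f : Subset n → Bool) (S : Subset n) → f S ≡ true → S ∈T tableOf f
  ∈-tableOf⁺ f [] e = e
  ∈-tableOf⁺ f (false ∷ S) e = ∈-tableOf⁺ (f ∘ (false ∷_)) S e
  ∈-tableOf⁺ f (true ∷ S) e = ∈-tableOf⁺ (f ∘ (true ∷_)) S e

  ∈-tableOf⁻ : (f : Subset n → Bool) (S : Subset n) → S ∈T tableOf f → f S ≡ true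
  ∈-tableOf⁻ f [] e = e
  ∈-tableOf⁻ f (false ∷ S) e = ∈-tableOf⁻ (f ∘ (false ∷_)) S e
  ∈-tableOf⁻ f (true ∷ S) e = ∈-tableOf⁻ (f ∘ (true ∷_)) S e

  _∈T?_ : (S : Subset n) (T : Table n) → Dec (S ∈T T)
  []          ∈T? b       = b Bool.≟ true
  (false ∷ S) ∈T? (T , _) = S ∈T? T
  (true  ∷ S) ∈T? (_ , T) = S ∈T? T

  table-ext : (T T' : Table n) → (∀ S → S ∈T T → S ∈T T') → (∀ S → S ∈T T' → S ∈T T) → T ≡ T'
  table-ext {zero} true b f g = sym (f [] refl)
  table-ext {zero} false false f g = refl
  table-ext {zero} false true f g = g [] refl
  table-ext {suc n} (T , U) (T' , U') f g =
    cong₂ _,_ (table-ext T T' (f ∘ (false ∷_)) (g ∘ (false ∷_))) (table-ext U U' (f ∘ (true ∷_)) (g ∘ (true ∷_)))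

  dot-neg : (a x : Point n) → dot (λ i → - a i) x ≡ - dot a x
  dot-neg {zero} a x = refl
  dot-neg {suc n} a x = trans (cong₂ _+_ (sym (neg-distribˡ-* (a zero) (x zero))) (dot-neg (a ∘ suc) (x ∘ suc)))
    (sym (neg-distrib-+ (a zero * x zero) (dot (a ∘ suc) (x ∘ suc))))

  neg-cancel-≤ : ∀ {p q} → - p ≤ - q → q ≤ p
  neg-cancel-≤ {p} {q} h = subst₂ _≤_ (neg-involutive q) (neg-involutive p) (neg-antimono-≤ h)
    where open import Algebra.Properties.Group +-0-group using () renaming (⁻¹-involutive to neg-involutive)

  conv-≥ : ∀ {P : Subset n → Set} (a : Point n) {b} → (∀ A → P A → b ≤ value a A) → ∀ {x} → conv P x → b ≤ dot a x
  conv-≥ a {b} h {x} c = neg-cancel-≤ (subst (_≤ - b) (dot-neg a x)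
    (conv-≤ (λ i → - a i) (λ A p → subst (_≤ - b) (sym (dot-neg a (indicator A))) (neg-antimono-≤ (h A p))) c))

  module _ (k : ℕ) where

    lowTable : Subset n → ℕ → Table n
    lowTable A j = tableOf (λ S → does ((∣ S ∣ ℕ.≟ k) ×-dec (cnt A S ℕ.≤? j)))

    -- The upper cell is written as a lower one, for `∁ A` at level `k ∸ j`, so that each property
    -- of a cell has to be shown only once.
    splitOf : Subset n → ℕ → Table n × Table n
    splitOf A j = lowTable A j , lowTable (∁ A) (k ∸ j)

    ∈low⁺ : (A : Subset n) (j : ℕ) {S : Subset n} → ∣ S ∣ ≡ k → cnt A S ℕ.≤ j → S ∈T lowTable A j
    ∈low⁺ A j {S} e h = ∈-tableOf⁺ _ S (dec-true ((∣ S ∣ ℕ.≟ k) ×-dec (cnt A S ℕ.≤? j)) (e , h))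

    ∈low⁻ : (A : Subset n) (j : ℕ) {S : Subset n} → S ∈T lowTable A j → ∣ S ∣ ≡ k × cnt A S ℕ.≤ j
    ∈low⁻ A j {S} m = from ((∣ S ∣ ℕ.≟ k) ×-dec (cnt A S ℕ.≤? j)) (∈-tableOf⁻ _ S m)
      where
      from : ∀ {P : Set} (d : Dec P) → does d ≡ true → P
      from (yes p) _ = p

    high⇒ : (A : Subset n) {j : ℕ} → j ℕ.≤ k → (S : Subset n) → ∣ S ∣ ≡ k → cnt (∁ A) S ℕ.≤ k ∸ j → j ℕ.≤ cnt A S
    high⇒ A {j} j≤k S e h = ℕₚ.+-cancelʳ-≤ (k ∸ j) j (cnt A S) (begin
      j ℕ.+ (k ∸ j)           ≡⟨ ℕₚ.m+[n∸m]≡n j≤k ⟩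
      k                       ≡⟨ trans (cnt-∁ A S) e ⟨
      cnt A S ℕ.+ cnt (∁ A) S ≤⟨ ℕₚ.+-monoʳ-≤ (cnt A S) h ⟩
      cnt A S ℕ.+ (k ∸ j)     ∎)
      where open ℕₚ.≤-Reasoning

    ⇒high : (A : Subset n) {j : ℕ} (S : Subset n) → ∣ S ∣ ≡ k → j ℕ.≤ cnt A S → cnt (∁ A) S ℕ.≤ k ∸ j
    ⇒high A {j} S e h = subst (ℕ._≤ k ∸ j)
      (trans (cong (_∸ cnt A S) (trans (sym e) (sym (cnt-∁ A S)))) (ℕₚ.m+n∸m≡n (cnt A S) (cnt (∁ A) S)))
      (ℕₚ.∸-monoʳ-≤ k h)

    splitOf-∁ : (A : Subset n) {j : ℕ} → j ℕ.≤ k → splitOf (∁ A) (k ∸ j) ≡ (lowTable (∁ A) (k ∸ j) , lowTable A j)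
    splitOf-∁ A {j} j≤k = cong₂ (λ B i → lowTable (∁ A) (k ∸ j) , lowTable B i) (∁-involutive A) (ℕₚ.m∸[m∸n]≡n j≤k)

    -- The other cell satisfies the opposite inequality, so common points are tight. Conversely, a
    -- tight point is a combination of tight vertices, and these belong to both tables.
    low-face : (A : Subset n) {j : ℕ} → j ℕ.≤ k →
               IsFace (cell (proj₁ (splitOf A j))) (cell (proj₁ (splitOf A j)) ∩P cell (proj₂ (splitOf A j)))
    low-face A {j} j≤k = indicator A , ι j , valid , λ x → into x , outof x
      where
      below : ∀ S → S ∈T lowTable A j → value (indicator A) S ≤ ι j
      below S m = subst (_≤ ι j) (sym (value-indicator A S)) (ι-mono-≤ (proj₂ (∈low⁻ A j m)))
      above : ∀ S → S ∈T lowTable (∁ A) (k ∸ j) → ι j ≤ value (indicator A) S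
      above S m with ∈low⁻ (∁ A) (k ∸ j) m
      ... | e , h = subst (ι j ≤_) (sym (value-indicator A S)) (ι-mono-≤ (high⇒ A j≤k S e h))
      valid : ∀ x → cell (lowTable A j) x → dot (indicator A) x ≤ ι j
      valid x = conv-≤ (indicator A) below
      into : ∀ x → cell (lowTable A j) x × cell (lowTable (∁ A) (k ∸ j)) x → cell (lowTable A j) x ×
          dot (indicator A) x ≡ ι j
      into x (c , d) = c , ≤-antisym (valid x c) (conv-≥ (indicator A) above d)
      outof : ∀ x → cell (lowTable A j) x × dot (indicator A) x ≡ ι j → cell (lowTable A j) x ×
          cell (lowTable (∁ A) (k ∸ j)) x
      outof x (c , e) = c , conv-mono
        (λ S (m , v) → ∈low⁺ (∁ A) (k ∸ j) (proj₁ (∈low⁻ A j m))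
           (⇒high A {j} S (proj₁ (∈low⁻ A j m))
               (ℕₚ.≤-reflexive (ι-injective (trans (sym v) (value-indicator A S))))))
        (conv-tight (indicator A) below c e)

    -- The witness is a vertex strictly below the hyperplane: one element of `A` fewer than on it,
    -- hence one of `∁ A` more, for which the last bound leaves room.
    low-⊈ : (A : Subset n) {j : ℕ} → 1 ℕ.≤ j → j ℕ.≤ k → j ℕ.≤ ∣ A ∣ → k ∸ j ℕ.< ∣ ∁ A ∣ →
            ¬ (cell (proj₁ (splitOf A j)) ⊆P cell (proj₂ (splitOf A j)))
    low-⊈ A {suc j} _ j<k j≤A kj<∁A sub with pickCounts A j (suc (k ∸ suc j)) (ℕₚ.≤-trans (ℕₚ.n≤1+n j) j≤A) kj<∁A
    ... | S , e₁ , e₂ = ℕₚ.<⇒≱ (ℕₚ.n<1+n j)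
        (subst (suc j ℕ.≤_) e₁ (ι-cancel-≤ (subst (ι (suc j) ≤_) (value-indicator A S)
          (conv-≥ (indicator A) above (sub (indicator S) (vertex {P = S} S∈))))))
      where
      card : ∣ S ∣ ≡ k
      card = trans (sym (cnt-∁ A S)) (trans (cong₂ ℕ._+_ e₁ e₂) (trans (ℕₚ.+-suc j _) (ℕₚ.m+[n∸m]≡n j<k)))
      S∈ : S ∈T lowTable A (suc j)
      S∈ = ∈low⁺ A (suc j) card (ℕₚ.≤-trans (ℕₚ.≤-reflexive e₁) (ℕₚ.n≤1+n j))
      above : ∀ S → S ∈T lowTable (∁ A) (k ∸ suc j) → ι (suc j) ≤ value (indicator A) S
      above S m with ∈low⁻ (∁ A) (k ∸ suc j) m
      ... | e , h = subst (ι (suc j) ≤_) (sym (value-indicator A S)) (ι-mono-≤ (high⇒ A j<k S e h))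

    -- Together the bounds say that vertices with `j - 1` and with `j + 1` elements of `A` both
    -- exist.
    record SplitData (A : Subset n) (j : ℕ) : Set where
      constructor splitData
      field
        1≤j  : 1 ℕ.≤ j
        j<k  : j ℕ.< k
        j<A  : j ℕ.< ∣ A ∣
        j<∁A : k ∸ j ℕ.< ∣ ∁ A ∣

    splitOf-isSplit : (A : Subset n) {j : ℕ} → SplitData A j → IsSplit k n (splitOf A j)
    splitOf-isSplit {n} A {j} (splitData 1≤j j<k j<A j<∁A) =
        (λ S m → proj₁ (∈low⁻ A j m))
      , (λ S m → proj₁ (∈low⁻ (∁ A) (k ∸ j) m))
      , (λ x c → Sum.map (conv-mono (λ S p → ∈low⁺ A j (proj₁ p) (proj₂ p)))
                         (conv-mono (λ S p → ∈low⁺ (∁ A) (k ∸ j) (proj₁ p) (⇒high A S (proj₁ p) (proj₂ p))))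
                         (hypersimplex-cover k j A x c))
      , low-face A j≤k
      -- For the second cell the complementary description is used; its tables come in the opposite
      -- order.
      , comm-face (subst (λ s → IsFace (cell (proj₁ s)) (cell (proj₁ s) ∩P cell (proj₂ s))) (splitOf-∁ A j≤k)
                    (low-face (∁ A) (ℕₚ.m∸n≤m k j)))
      , low-⊈ A 1≤j j≤k (ℕₚ.<⇒≤ j<A) j<∁A
      , subst (λ s → ¬ (cell (proj₁ s) ⊆P cell (proj₂ s))) (splitOf-∁ A j≤k)
          (low-⊈ (∁ A) (ℕₚ.m<n⇒0<n∸m j<k) (ℕₚ.m∸n≤m k j) (ℕₚ.<⇒≤ j<∁A)
            (subst₂ ℕ._<_ (sym (ℕₚ.m∸[m∸n]≡n j≤k)) (cong ∣_∣ (sym (∁-involutive A))) j<A))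
      where
      j≤k = ℕₚ.<⇒≤ j<k
      comm-face : ∀ {Q P P' : PSet n} → IsFace Q (P ∩P P') → IsFace Q (P' ∩P P)
      comm-face (a , b , valid , char) = a , b , valid , λ x →
        (λ (p' , p) → proj₁ (char x) (p , p')) , (λ q → let p , p' = proj₂ (char x) q in p' , p)

  -- Functionals along exchanges, and recognising the vertices of a cell

  adj-sym : ∀ {S S' : Subset n} {i j} → Adj S S' i j → Adj S' S j i
  adj-sym (adj a b c d e) = adj d c b a (λ p p≢j p≢i → sym (e p p≢i p≢j))

  value-exchange : (a : Point n) {S S' : Subset n} {i j : Fin n} → Adj S S' i j → value a S' ≡ value a S +
      (a j - a i)
  value-exchange a {S} {S'} {i} {j} e = begin
    value a S'                     ≡⟨ solve 2 (λ x y → y := x :+ y :- x) refl (a i) (value a S') ⟩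
    a i + value a S' - a i         ≡⟨ cong (_- a i) (value-adj a e) ⟨
    a j + value a S - a i          ≡⟨ solve 3 (λ x y z → x :+ y :- z := y :+ (x :- z)) refl (a j)
        (value a S) (a i) ⟩
    value a S + (a j - a i)        ∎
    where open ≡-Reasoning

  exchange-≤ᵛ : (a : Point n) {S S' : Subset n} {i j : Fin n} → Adj S S' i j → a j ≤ a i → value a S' ≤ value a S
  exchange-≤ᵛ a {S} {i = i} {j} e h = subst₂ _≤_ (sym (value-exchange a e)) (+-identityʳ (value a S))
    (+-monoʳ-≤ (value a S) (subst (a j - a i ≤_) (+-inverseʳ (a i)) (+-monoˡ-≤ (- a i) h)))

  exchange-<ᵛ : (a : Point n) {S S' : Subset n} {i j : Fin n} → Adj S S' i j → a j < a i → value a S' < value a S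
  exchange-<ᵛ a {S} {i = i} {j} e h = subst₂ _<_ (sym (value-exchange a e)) (+-identityʳ (value a S))
    (+-monoʳ-< (value a S) (subst (a j - a i <_) (+-inverseʳ (a i)) (+-monoˡ-< (- a i) h)))

  -- Opaque, because `with` on the order tests of ℚ unfolds them to integer arithmetic.
  abstract
    <-or-≥ : (p q : ℚ) → p < q ⊎ q ≤ p
    <-or-≥ p q with p <? q
    ... | yes h = inj₁ h
    ... | no h = inj₂ (≮⇒≥ h)

    compare : (p q : ℚ) → Tri (p < q) (p ≡ q) (q < p)
    compare = <-cmp

    equal? : (p q : ℚ) → Dec (p ≡ q)
    equal? = _≟_

  ≮-refl : ∀ {p : ℚ} → ¬ (p < p)
  ≮-refl = <-irrefl refl

  swap-∉⁻ : (Z : Subset n) {i j p : Fin n} → p ≢ i → p ∉ᵇ swap Z i j → p ∉ᵇ Z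
  swap-∉⁻ Z {i} {j} {p} p≢i p∉ with p Fin.≟ j
  ... | yes refl = contradiction (trans (sym (swap-in Z)) p∉) true≢false
  ... | no p≢j = trans (sym (swap-other Z p≢i p≢j)) p∉

  swap-∈⁻ : (Z : Subset n) {i j p : Fin n} → i ≢ j → p ≢ j → p ∈ᵇ swap Z i j → p ∈ᵇ Z
  swap-∈⁻ Z {i} {j} {p} i≢j p≢j p∈ with p Fin.≟ i
  ... | yes refl = contradiction (trans (sym p∈) (swap-out Z i≢j)) true≢false
  ... | no p≢i = trans (sym (swap-other Z p≢i p≢j)) p∈

  Descent : (a : Point n) (Y Z : Subset n) → Set
  Descent a Y Z = ∃₂ λ i j → i ∈ᵇ Y × i ∉ᵇ Z × j ∈ᵇ Z × j ∉ᵇ Y × a j < a i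

  -- If the chosen pair does not descend, it is exchanged in `Z` instead. This does not raise the
  -- value of `Z` and brings it closer to `Y`, which it cannot reach while its value is smaller. A
  -- descent found later also serves the original `Z`, since the difference from `Y` only shrinks.
  descent : (a : Point n) (Y Z : Subset n) → ∣ Y ∣ ≡ ∣ Z ∣ → value a Z < value a Y → Descent a Y Z
  descent {n} a Y Z = go (suc (hamming Y Z)) Z (ℕₚ.n<1+n _)
    where
    widen : ∀ Z {i j} → i ∈ᵇ Y → i ∉ᵇ Z → j ∈ᵇ Z → j ∉ᵇ Y → Descent a Y (swap Z j i) → Descent a Y Z
    widen Z iY iZ jZ jY (i' , j' , iY' , iZ' , jZ' , jY' , h) =
      i' , j' , iY' , swap-∉⁻ Z (∈∉-≢ {S = Y} iY' jY) iZ' ,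
      swap-∈⁻ Z (∈∉-≢ {S = Z} jZ iZ) (λ e → ∈∉-≢ {S = Y} iY jY' (sym e)) jZ' , jY' , h

    go : ∀ N Z → hamming Y Z ℕ.< N → ∣ Y ∣ ≡ ∣ Z ∣ → value a Z < value a Y → Descent a Y Z
    go (suc N) Z (s≤s le) card lt with diff-≡ Y Z card
    ... | inj₁ refl = contradiction lt ≮-refl
    ... | inj₂ (i , j , (iY , iZ) , (jZ , jY)) = [ found , shift ]′ (<-or-≥ (a j) (a i))
      where
      found : a j < a i → Descent a Y Z
      found h = i , j , iY , iZ , jZ , jY , h
      shift : a i ≤ a j → Descent a Y Z
      shift h = widen Z iY iZ jZ jY (go N (swap Z j i)
        (ℕₚ.≤-trans (subst₂ ℕ._<_ (hamming-sym (swap Z j i) Y) (hamming-sym Z Y) (hamming-swap Z Y jZ jY iY iZ)) le)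
        (trans card (sym (card-adj (swap-adj Z jZ iZ)))) (≤-<-trans (exchange-≤ᵛ a (swap-adj Z jZ iZ) h) lt))

  -- For fixed cardinality the functional is thus an affine function of `cnt A`, increasing if
  -- `α < β`, so both order vertices alike.
  two-valued : (α β : ℚ) (a : Point n) (A : Subset n) → (∀ i → a i ≡ (if lookup A i then β else α)) →
               ∀ S → value a S ≡ α * ι ∣ S ∣ + (β - α) * ι (cnt A S)
  two-valued α β a [] h [] = solve 2 (λ x y → con 0ℚ := x :* con 0ℚ :+ y :* con 0ℚ) refl α (β - α)
  two-valued α β a (x ∷ A) h (false ∷ S) =
    trans (cong₂ _+_ (*-zeroʳ (a zero)) (two-valued α β (a ∘ suc) A (h ∘ suc) S)) (+-identityˡ _)
  two-valued α β a (true ∷ A) h (true ∷ S) =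
    trans (cong₂ (λ x y → x * 1ℚ + y) (h zero) (two-valued α β (a ∘ suc) A (h ∘ suc) S))
      (solve 4 (λ α β s c → β :* con 1ℚ :+ (α :* s :+ (β :- α) :* c)
          := α :* (con 1ℚ :+ s) :+ (β :- α) :* (con 1ℚ :+ c))
         refl α β (ι ∣ S ∣) (ι (cnt A S)))
  two-valued α β a (false ∷ A) h (true ∷ S) =
    trans (cong₂ (λ x y → x * 1ℚ + y) (h zero) (two-valued α β (a ∘ suc) A (h ∘ suc) S))
      (solve 4 (λ α β s c → α :* con 1ℚ :+ (α :* s :+ (β :- α) :* c) := α :* (con 1ℚ :+ s) :+ (β :- α) :* c)
         refl α β (ι ∣ S ∣) (ι (cnt A S)))

  cnt-pos : (A S : Subset n) {i : Fin n} → i ∈ᵇ A → i ∈ᵇ S → 1 ℕ.≤ cnt A S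
  cnt-pos (true ∷ A) (true ∷ S) {zero} refl refl = s≤s z≤n
  cnt-pos (a ∷ A) (false ∷ S) {suc i} p q = cnt-pos A S p q
  cnt-pos (false ∷ A) (true ∷ S) {suc i} p q = cnt-pos A S p q
  cnt-pos (true ∷ A) (true ∷ S) {suc i} p q = s≤s z≤n

  cnt≤∣A∣ : (A S : Subset n) → cnt A S ℕ.≤ ∣ A ∣
  cnt≤∣A∣ [] [] = z≤n
  cnt≤∣A∣ (true ∷ A) (true ∷ S) = s≤s (cnt≤∣A∣ A S)
  cnt≤∣A∣ (true ∷ A) (false ∷ S) = ℕₚ.m≤n⇒m≤1+n (cnt≤∣A∣ A S)
  cnt≤∣A∣ (false ∷ A) (true ∷ S) = cnt≤∣A∣ A S
  cnt≤∣A∣ (false ∷ A) (false ∷ S) = cnt≤∣A∣ A S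

  cnt<∣A∣ : (A S : Subset n) {i : Fin n} → i ∈ᵇ A → i ∉ᵇ S → cnt A S ℕ.< ∣ A ∣
  cnt<∣A∣ (true ∷ A) (false ∷ S) {zero} refl refl = s≤s (cnt≤∣A∣ A S)
  cnt<∣A∣ (true ∷ A) (true ∷ S) {suc i} p q = s≤s (cnt<∣A∣ A S p q)
  cnt<∣A∣ (true ∷ A) (false ∷ S) {suc i} p q = ℕₚ.m≤n⇒m≤1+n (cnt<∣A∣ A S p q)
  cnt<∣A∣ (false ∷ A) (true ∷ S) {suc i} p q = cnt<∣A∣ A S p q
  cnt<∣A∣ (false ∷ A) (false ∷ S) {suc i} p q = cnt<∣A∣ A S p q

  -- S is the only k-subset that contains i and agrees with S off {i, j}.
  support-edge : ∀ {k} {T : Table n} → (∀ A → A ∈T T → ∣ A ∣ ≡ k) → ∀ {S S' : Subset n} {i j} →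
      Adj S S' i j → ∣ S ∣ ≡ k →
                 ∀ {x} → (∀ p → p ≢ i → p ≢ j → x p ≡ indicator S p) → 0ℚ < x i → cell T x → S ∈T T
  support-edge {n} {k} {T} sub {S} {S'} {i} {j} e@(adj iS jS iS' jS' same) kS {x} agree 0<xi c
    with support c 0<xi
  ... | B , B∈T , iB , dec = subst (_∈T T) (lookup-ext B S eq) B∈T
    where
    off-ij : ∀ p → p ≢ i → p ≢ j → lookup B p ≡ lookup S p
    off-ij p p≢i p≢j with ∈-or-∉ S p
    ... | inj₁ pS = trans (proj₂ (dec p) (trans (agree p p≢i p≢j) (indicator-∈ S pS))) (sym pS)
    ... | inj₂ pS = trans (proj₁ (dec p) (trans (agree p p≢i p≢j) (indicator-∉ S pS))) (sym pS)
    -- Otherwise `B` would be `S'` with `i` added, one element too many.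
    jB : j ∉ᵇ B
    jB with ∈-or-∉ B j
    ... | inj₂ h = h
    ... | inj₁ h = contradiction (trans (trans (sym (card-off B S' o)) (sub B B∈T))
        (trans (sym kS) (sym (card-adj e)))) ℕₚ.1+n≢n
      where
      off-i : ∀ p → p ≢ i → lookup B p ≡ lookup S' p
      off-i p p≢i with p Fin.≟ j
      ... | yes refl = trans h (sym jS')
      ... | no p≢j = trans (off-ij p p≢i p≢j) (same p p≢i p≢j)
      o : Off B S' i
      o = off iB iS' off-i
    eq : ∀ p → lookup B p ≡ lookup S p
    eq p with p Fin.≟ i | p Fin.≟ j
    ... | yes refl | _ = trans iB (sym iS)
    ... | no _ | yes refl = trans jB (sym jS)
    ... | no p≢i | no p≢j = off-ij p p≢i p≢j

  -- Every coordinate of `indicator S` is extremal, so `support` determines its vertex completely;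
  -- `i` provides the positive coordinate that `support` starts from.
  vertex-∈ : ∀ {T : Table n} {S : Subset n} {i} → i ∈ᵇ S → cell T (indicator S) → S ∈T T
  vertex-∈ {T = T} {S} {i} iS c with support c (subst (0ℚ <_) (sym (indicator-∈ S iS)) 0<1)
  ... | B , B∈T , _ , dec = subst (_∈T T) (lookup-ext B S eq) B∈T
    where
    eq : ∀ p → lookup B p ≡ lookup S p
    eq p with ∈-or-∉ S p
    ... | inj₁ pS = trans (proj₂ (dec p) (indicator-∈ S pS)) (sym pS)
    ... | inj₂ pS = trans (proj₁ (dec p) (indicator-∉ S pS)) (sym pS)

  -- The classification of splits, in terms of vertices alone

  module Separation {n k : ℕ} (T₁ T₂ : Table n) (a : Point n) (b : ℚ)
    (sub₁ : ∀ S → S ∈T T₁ → ∣ S ∣ ≡ k) (sub₂ : ∀ S → S ∈T T₂ → ∣ S ∣ ≡ k)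
    (covered : ∀ S → ∣ S ∣ ≡ k → S ∈T T₁ ⊎ S ∈T T₂)
    (edge : ∀ {S S' i j} → Adj S S' i j → ∣ S ∣ ≡ k → (S ∈T T₁ × S' ∈T T₁) ⊎ (S ∈T T₂ × S' ∈T T₂))
    (≤b : ∀ {S} → S ∈T T₁ → value a S ≤ b)
    (≡b : ∀ {S} → S ∈T T₁ → S ∈T T₂ → value a S ≡ b)
    (≡b⇒∈T₂ : ∀ {S} → S ∈T T₁ → value a S ≡ b → S ∈T T₂)
    (Z₀ : Subset n) (Z₀∈V₁ : Z₀ ∈T T₁ × ¬ Z₀ ∈T T₂) (W₀ : Subset n) (W₀∈V₂ : W₀ ∈T T₂ × ¬ W₀ ∈T T₁) where
    private
      K : Subset n → Set
      K S = ∣ S ∣ ≡ k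

      v : Subset n → ℚ
      v = value a

      V₁ V₂ : Subset n → Set
      V₁ S = S ∈T T₁ × ¬ S ∈T T₂
      V₂ S = S ∈T T₂ × ¬ S ∈T T₁

      V₁-< : ∀ {S} → V₁ S → v S < b
      V₁-< (m , m') = ≤∧≢⇒< (≤b m) (λ e → m' (≡b⇒∈T₂ m e))

      -- An edge lies within one cell, and a vertex of both cells has value `b`; hence a step to a
      -- value below `b` cannot leave the side.
      V₂-step : ∀ {S S' i j} → Adj S S' i j → V₂ S → v S' < b → V₂ S'
      V₂-step e (m , m') lt with edge e (sub₂ _ m)
      ... | inj₁ (p , _) = contradiction p m'
      ... | inj₂ (_ , p) = p , λ p' → <⇒≢ lt (≡b p' p)

      V₁-step : ∀ {S S' i j} → Adj S S' i j → V₁ S → v S' < b → V₁ S'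
      V₁-step e (m , m') lt with edge e (sub₁ _ m)
      ... | inj₂ (p , _) = contradiction p m'
      ... | inj₁ (_ , p) = p , λ p' → <⇒≢ lt (≡b p p')

      -- Exchanging towards each other, either Y or Z moves without increasing v, hence stays on its side.
      no-V₂-below : ∀ N {Y Z} → hamming Y Z ℕ.< N → V₂ Y → V₁ Z → ¬ (v Y < b)
      no-V₂-below (suc N) {Y} {Z} (s≤s le) y z lt with diff-≡ Y Z
          (trans (sub₂ Y (proj₁ y)) (sym (sub₁ Z (proj₁ z))))
      ... | inj₁ refl = proj₂ y (proj₁ z)
      ... | inj₂ (i , j , (iY , iZ) , (jZ , jY)) with <-or-≥ (a i) (a j)
      ... | inj₂ h =
        let e = swap-adj Y iY jY
            lt' = ≤-<-trans (exchange-≤ᵛ a e h) lt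
        in no-V₂-below N (ℕₚ.≤-trans (hamming-swap Y Z iY iZ jZ jY) le) (V₂-step e y lt') z lt'
      ... | inj₁ h =
        let e = swap-adj Z jZ iZ
            lt' = ≤-<-trans (exchange-≤ᵛ a e (<⇒≤ h)) (V₁-< z)
        in no-V₂-below N {Y} (ℕₚ.≤-trans
               (subst₂ ℕ._<_ (hamming-sym (swap Z j i) Y) (hamming-sym Z Y) (hamming-swap Z Y jZ jY iY iZ)) le)
             y (V₁-step e z lt') lt

      -- The value `b` itself is excluded as well: some exchange towards `Z₀` lowers it, and leads
      -- to a vertex of the second cell alone with value below `b`.
      V₂-> : ∀ {S} → V₂ S → b < v S
      V₂-> {S} s with compare (v S) b
      ... | tri< lt _ _ = contradiction lt (no-V₂-below _ (ℕₚ.n<1+n _) s Z₀∈V₁)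
      ... | tri> _ _ gt = gt
      ... | tri≈ _ e _ =
        let i , j , iS , _ , _ , jS , h = descent a S Z₀ (trans (sub₂ S (proj₁ s)) (sym (sub₁ Z₀ (proj₁ Z₀∈V₁))))
                                            (subst (v Z₀ <_) (sym e) (V₁-< Z₀∈V₁))
            A = swap-adj S iS jS
            lt = subst (v (swap S i j) <_) e (exchange-<ᵛ a A h)
        in contradiction lt (no-V₂-below _ (ℕₚ.n<1+n _) (V₂-step A s lt) Z₀∈V₁)

      b≤ : ∀ {S} → S ∈T T₂ → b ≤ v S
      b≤ {S} m with S ∈T? T₁
      ... | yes m' = ≤-reflexive (sym (≡b m' m))
      ... | no m' = <⇒≤ (V₂-> (m , m'))

      b≤⇒ : ∀ S → K S → b ≤ v S → S ∈T T₂
      b≤⇒ S kS h with covered S kS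
      ... | inj₂ m = m
      ... | inj₁ m = ≡b⇒∈T₂ m (≤-antisym (≤b m) h)

      ≤b⇒ : ∀ S → K S → v S ≤ b → S ∈T T₁
      ≤b⇒ S kS h with covered S kS
      ... | inj₁ m = m
      ... | inj₂ m = decidable-stable (S ∈T? T₁) (λ m' → ≮-refl (<-≤-trans (V₂-> (m , m')) h))

      no-crossing : ∀ {S S' i j} → Adj S S' i j → K S → v S < b → ¬ (b < v S')
      no-crossing e kS lt gt with edge e kS
      ... | inj₁ (_ , m) = ≮-refl (<-≤-trans gt (≤b m))
      ... | inj₂ (m , _) = ≮-refl (<-≤-trans lt (b≤ m))

      -- On a walk to `W₀`, whose value exceeds `b`, no edge jumps over `b`, so some vertex must hit
      -- it.
      on-hyperplane : ∀ N {Z} → hamming Z W₀ ℕ.< N → K Z → v Z < b → ∃ λ S → K S × v S ≡ b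
      on-hyperplane (suc N) {Z} (s≤s le) kZ lt with diff-≡ Z W₀ (trans kZ (sym (sub₂ W₀ (proj₁ W₀∈V₂))))
      ... | inj₁ refl = contradiction (<-trans lt (V₂-> W₀∈V₂)) ≮-refl
      ... | inj₂ (i , j , (iZ , iW) , (jW , jZ)) with swap-adj Z iZ jZ | compare (v (swap Z i j)) b
      ... | e | tri≈ _ eq _ = swap Z i j , trans (card-adj e) kZ , eq
      ... | e | tri> _ _ gt = contradiction gt (no-crossing e kZ lt)
      ... | e | tri< lt' _ _ = on-hyperplane N {swap Z i j} (ℕₚ.≤-trans (hamming-swap Z W₀ iZ iW jW jZ) le)
          (trans (card-adj e) kZ) lt'

      module _ {S : Subset n} (kS : K S) (vS : v S ≡ b) where

        drop : ∀ {i j} → i ∈ᵇ S → j ∉ᵇ S → a j < a i → v (swap S i j) < b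
        drop {i} {j} iS jS h = subst (v (swap S i j) <_) vS (exchange-<ᵛ a (swap-adj S iS jS) h)

        rise : ∀ {i j} → i ∈ᵇ S → j ∉ᵇ S → a i < a j → b < v (swap S i j)
        rise {i} {j} iS jS h = subst (_< v (swap S i j)) vS (exchange-<ᵛ a (adj-sym (swap-adj S iS jS)) h)

        -- Otherwise the adjacent sets S - x + y and S - x + y' lie strictly on different sides of the hyperplane.
        no-straddle-in : ∀ {x y y'} → x ∈ᵇ S → y ∉ᵇ S → y' ∉ᵇ S → a y < a x → ¬ (a x < a y')
        no-straddle-in {x} {y} {y'} xS yS y'S h h' =
          no-crossing e (trans (card-adj (swap-adj S xS yS)) kS) (drop xS yS h) (rise xS y'S h')
          where
          y≢y' : y ≢ y'
          y≢y' refl = ≮-refl (<-trans h h')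
          y≢x : y ≢ x
          y≢x refl = ≮-refl h
          y'≢x : y' ≢ x
          y'≢x refl = ≮-refl h'
          same : ∀ p → p ≢ y → p ≢ y' → lookup (swap S x y) p ≡ lookup (swap S x y') p
          same p p≢y p≢y' with p Fin.≟ x
          ... | yes refl = trans (swap-out S (y≢x ∘ sym)) (sym (swap-out S (y'≢x ∘ sym)))
          ... | no p≢x = trans (swap-other S p≢x p≢y) (sym (swap-other S p≢x p≢y'))
          e : Adj (swap S x y) (swap S x y') y y'
          e = adj (swap-in S) (trans (swap-other S y'≢x (y≢y' ∘ sym)) y'S)
                  (trans (swap-other S y≢x y≢y') yS) (swap-in S) same

        -- The dual argument, with the adjacent sets S - x' + y and S - x + y.
        no-straddle-out : ∀ {y x x'} → y ∉ᵇ S → x ∈ᵇ S → x' ∈ᵇ S → a x < a y → ¬ (a y < a x')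
        no-straddle-out {y} {x} {x'} yS xS x'S h h' =
          no-crossing e (trans (card-adj (swap-adj S x'S yS)) kS) (drop x'S yS h') (rise xS yS h)
          where
          x≢x' : x ≢ x'
          x≢x' refl = ≮-refl (<-trans h h')
          x≢y : x ≢ y
          x≢y refl = ≮-refl h
          x'≢y : x' ≢ y
          x'≢y refl = ≮-refl h'
          same : ∀ p → p ≢ x → p ≢ x' → lookup (swap S x' y) p ≡ lookup (swap S x y) p
          same p p≢x p≢x' with p Fin.≟ y
          ... | yes refl = trans (swap-in S) (sym (swap-in S))
          ... | no p≢y = trans (swap-other S p≢x' p≢y) (sym (swap-other S p≢x p≢y))
          e : Adj (swap S x' y) (swap S x y) x x'
          e = adj (trans (swap-other S x≢x' x≢y) xS) (swap-out S x'≢y)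
                  (swap-out S x≢y) (trans (swap-other S (x≢x' ∘ sym) x'≢y) x'S) same

    classification : ∃₂ λ A j → SplitData k A j × (T₁ , T₂) ≡ splitOf k A j
    classification =
      let S , kS , vS = on-hyperplane _ {Z₀} (ℕₚ.n<1+n _) (sub₁ Z₀ (proj₁ Z₀∈V₁)) (V₁-< Z₀∈V₁)
          p , q , pS , _ , _ , qS , q<p = descent a S Z₀ (trans kS (sym (sub₁ Z₀ (proj₁ Z₀∈V₁))))
              (subst (v Z₀ <_) (sym vS) (V₁-< Z₀∈V₁))
          -- Read backwards, this descent from `W₀` is an exchange at `S` of `r` for `t` that raises
          -- the value.
          t , r , _ , tS , rS , _ , r<t = descent a W₀ S (trans (sub₂ W₀ (proj₁ W₀∈V₂)) (sym kS))
              (subst (_< v W₀) (sym vS) (V₂-> W₀∈V₂))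
      in at S kS vS pS qS q<p rS tS r<t
      where
      at : ∀ S → K S → v S ≡ b → ∀ {p q} → p ∈ᵇ S → q ∉ᵇ S → a q < a p → ∀ {r t} → r ∈ᵇ S → t ∉ᵇ S → a r < a t →
           ∃₂ λ A j → SplitData k A j × (T₁ , T₂) ≡ splitOf k A j
      at S kS vS {p} {q} pS qS q<p {r} {t} rS tS r<t =
        A , j , splitData (cnt-pos A S p∈A pS) j<k (cnt<∣A∣ A S t∈A tS)
          (subst (ℕ._< ∣ ∁ A ∣) cnt∁ (cnt<∣A∣ (∁ A) S (∉⇒∈∁ A q∉A) qS))
        , cong₂ _,_
            (table-ext T₁ _ (λ X m → ∈low⁺ k A j (sub₁ X m)
                (cnt-reflect X S (sub₁ X m) kS (subst (v X ≤_) (sym vS) (≤b m))))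
                            (λ X m → let kX , h = ∈low⁻ k A j m in ≤b⇒ X kX (subst (v X ≤_) vS (cnt-mono X S kX kS h))))
            (table-ext T₂ _ (λ X m → ∈low⁺ k (∁ A) (k ∸ j) (sub₂ X m)
                               (⇒high k A X (sub₂ X m) (cnt-reflect S X kS (sub₂ X m)
                                   (subst (_≤ v X) (sym vS) (b≤ m)))))
                            (λ X m → let kX , h = ∈low⁻ k (∁ A) (k ∸ j) m in
                               b≤⇒ X kX (subst (_≤ v X) vS (cnt-mono S X kS kX (high⇒ k A (ℕₚ.<⇒≤ j<k) X kX h)))))
        where
        inside : ∀ {x y y'} → x ∈ᵇ S → y ∉ᵇ S → y' ∉ᵇ S → a y < a x → a y' ≤ a x
        inside xS yS y'S h = ≮⇒≥ (no-straddle-in {S} kS vS xS yS y'S h)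
        outside : ∀ {y x x'} → y ∉ᵇ S → x ∈ᵇ S → x' ∈ᵇ S → a x < a y → a x' ≤ a y
        outside yS xS x'S h = ≮⇒≥ (no-straddle-out {S} kS vS yS xS x'S h)
        inside' : ∀ {x y y'} → x ∈ᵇ S → y ∉ᵇ S → y' ∉ᵇ S → a x < a y' → a x ≤ a y
        inside' xS yS y'S h = ≮⇒≥ (λ h' → no-straddle-in {S} kS vS xS yS y'S h' h)
        outside' : ∀ {y x x'} → y ∉ᵇ S → x ∈ᵇ S → x' ∈ᵇ S → a y < a x' → a y ≤ a x
        outside' yS xS x'S h = ≮⇒≥ (λ h' → no-straddle-out {S} kS vS yS xS x'S h' h)

        -- The lowering exchange replaces `p` by `q`, the raising one `r` by `t`. The straddle
        -- conditions force `a r` to equal `a q` and `a p` to equal `a t`, which leaves two values.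
        α = a q
        β = a t
        r≡α : a r ≡ α
        r≡α = ≤-antisym (inside' rS qS tS r<t) (outside' qS rS pS q<p)
        p≡β : a p ≡ β
        p≡β = ≤-antisym (outside tS rS pS r<t) (inside pS qS tS q<p)
        α<β : α < β
        α<β = subst (α <_) p≡β q<p

        -- A value below `α` would straddle, whether or not `i` lies in `S`; a value above `α` is
        -- squeezed from both sides onto `β`.
        α-or-β : ∀ i → a i ≢ β → a i ≡ α
        α-or-β i ≢β with ∈-or-∉ S i | compare α (a i)
        ... | _ | tri≈ _ e _ = sym e
        ... | inj₁ iS | tri> _ _ h = contradiction (<-≤-trans h (outside' qS iS pS q<p)) ≮-refl
        ... | inj₁ iS | tri< h _ _ = contradiction (≤-antisym (outside tS rS iS r<t) (inside iS qS tS h)) ≢β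
        ... | inj₂ iS | tri> _ _ h = contradiction (<-≤-trans h (subst (_≤ a i) r≡α (inside' rS iS tS r<t))) ≮-refl
        ... | inj₂ iS | tri< h _ _ = contradiction
                (≤-antisym (subst (a i ≤_) p≡β (inside pS qS iS q<p))
                           (subst (_≤ a i) p≡β (outside iS rS pS (subst (_< a i) (sym r≡α) h)))) ≢β

        A : Subset n
        A = tabulate (λ i → does (equal? (a i) β))
        j = cnt A S

        two : ∀ i → a i ≡ (if lookup A i then β else α)
        two i rewrite lookup∘tabulate (λ i → does (equal? (a i) β)) i with equal? (a i) β
        ... | yes e = e
        ... | no e = α-or-β i e

        ∈A : ∀ {i} → a i ≡ β → i ∈ᵇ A
        ∈A {i} e = trans (lookup∘tabulate _ i) (dec-true (equal? (a i) β) e)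
        ∉A : ∀ {i} → a i ≡ α → i ∉ᵇ A
        ∉A {i} e with ∈-or-∉ A i
        ... | inj₂ h = h
        ... | inj₁ h = contradiction (subst (α <_)
            (sym (trans (sym e) (trans (two i) (cong (if_then β else α) h)))) α<β) ≮-refl

        p∈A = ∈A p≡β
        t∈A = ∈A {t} refl
        q∉A = ∉A {q} refl

        cnt∁ : cnt (∁ A) S ≡ k ∸ j
        cnt∁ = trans (sym (ℕₚ.m+n∸m≡n j (cnt (∁ A) S))) (cong (_∸ j) (trans (cnt-∁ A S) kS))

        j<k : j ℕ.< k
        j<k = subst₂ ℕ._≤_ (ℕₚ.+-comm j 1) (trans (cnt-∁ A S) kS)
            (ℕₚ.+-monoʳ-≤ j (cnt-pos (∁ A) S (∉⇒∈∁ A (∉A r≡α)) rS))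

        formula : ∀ X → K X → v X ≡ α * ι k + (β - α) * ι (cnt A X)
        formula X kX = trans (two-valued α β a A two X) (cong (λ m → α * ι m + (β - α) * ι (cnt A X)) kX)

        0<β-α : 0ℚ < β - α
        0<β-α = subst (_< β - α) (+-inverseʳ α) (+-monoˡ-< (- α) α<β)

        cnt-mono : ∀ X Y → K X → K Y → cnt A X ℕ.≤ cnt A Y → v X ≤ v Y
        cnt-mono X Y kX kY h = subst₂ _≤_ (sym (formula X kX)) (sym (formula Y kY))
          (+-monoʳ-≤ (α * ι k) (*-monoˡ-≤-nonNeg (β - α) {{nonNegative (<⇒≤ 0<β-α)}} (ι-mono-≤ h)))

        cnt-reflect : ∀ X Y → K X → K Y → v X ≤ v Y → cnt A X ℕ.≤ cnt A Y
        cnt-reflect X Y kX kY h = ℕₚ.≮⇒≥ λ lt → ≮-refl (<-≤-trans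
          (subst₂ _<_ (sym (formula Y kY)) (sym (formula X kX))
            (+-monoʳ-< (α * ι k) (*-monoʳ-<-pos (β - α) {{positive 0<β-α}} (ι-mono-< lt)))) h)

  -- Extracting the vertex data from a geometric split

  difference : {T T' : Table n} → ¬ (cell T ⊆P cell T') → ∃ λ S → S ∈T T × ¬ S ∈T T'
  difference {T = T} {T'} ⊈ with anySubset? (λ S → (S ∈T? T) ×-dec ¬? (S ∈T? T'))
  ... | yes w = w
  ... | no ¬w = contradiction (λ x → conv-mono (λ S m → decidable-stable (S ∈T? T') (λ m' → ¬w (S , m , m')))) ⊈

  module Completeness {n k : ℕ} (1≤k : 1 ℕ.≤ k) (T₁ T₂ : Table n) (split : IsSplit k n (T₁ , T₂)) where
    private
      K : Subset n → Set
      K S = ∣ S ∣ ≡ k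
      sub₁ = proj₁ split
      sub₂ = proj₁ (proj₂ split)
      cover = proj₁ (proj₂ (proj₂ split))
      face = proj₁ (proj₂ (proj₂ (proj₂ split)))
      a = proj₁ face
      b = proj₁ (proj₂ face)
      valid = proj₁ (proj₂ (proj₂ face))
      char = proj₂ (proj₂ (proj₂ face))
      ⊈₁ = proj₁ (proj₂ (proj₂ (proj₂ (proj₂ (proj₂ split)))))
      ⊈₂ = proj₂ (proj₂ (proj₂ (proj₂ (proj₂ (proj₂ split)))))

      v : Subset n → ℚ
      v = value a

      element : ∀ S → K S → ∃ λ i → i ∈ᵇ S
      element S kS with diff-≤ S ⊥ (subst₂ ℕ._≤_ (sym (∣⊥∣≡0 n)) refl z≤n)
      ... | inj₂ (i , p , _) = i , p
      ... | inj₁ refl = contradiction (subst (1 ℕ.≤_) (trans (sym kS) (∣⊥∣≡0 n)) 1≤k) λ ()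

      covered : ∀ S → K S → S ∈T T₁ ⊎ S ∈T T₂
      covered S kS = Sum.map (vertex-∈ (proj₂ (element S kS))) (vertex-∈ (proj₂ (element S kS)))
          (cover (indicator S) (vertex {P = S} kS))

      -- Some cell contains the midpoint. Its coordinates at `i` and `j` are positive, so that cell
      -- needs a vertex containing `i` and one containing `j`, and these can only be the two ends.
      edge : ∀ {S S' i j} → Adj S S' i j → K S → (S ∈T T₁ × S' ∈T T₁) ⊎ (S ∈T T₂ × S' ∈T T₂)
      edge {S} {S'} {i} {j} e@(adj iS jS iS' jS' same) kS = Sum.map (both sub₁) (both sub₂)
          (cover m (midpoint-conv {S = S} {S'} kS kS'))
        where
        m = midpoint S S'
        kS' = trans (card-adj e) kS
        0<mi : 0ℚ < m i
        0<mi = subst (0ℚ <_) (sym (cong₂ (λ s t → ½ * s + ½ * t) (indicator-∈ S iS) (indicator-∉ S' iS')))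
            (positive⁻¹ ½)
        0<mj : 0ℚ < m j
        0<mj = subst (0ℚ <_) (sym (cong₂ (λ s t → ½ * s + ½ * t) (indicator-∉ S jS) (indicator-∈ S' jS')))
            (positive⁻¹ ½)
        half : ∀ t → ½ * t + ½ * t ≡ t
        half = solve 1 (λ t → con ½ :* t :+ con ½ :* t := t) refl
        agree : ∀ p → p ≢ i → p ≢ j → m p ≡ indicator S p
        agree p p≢i p≢j = trans (cong (λ t → ½ * indicator S p + ½ * (if t then 1ℚ else 0ℚ))
            (sym (same p p≢i p≢j))) (half (indicator S p))
        agree' : ∀ p → p ≢ j → p ≢ i → m p ≡ indicator S' p
        agree' p p≢j p≢i = trans (cong (λ t → ½ * (if t then 1ℚ else 0ℚ) + ½ * indicator S' p)
            (same p p≢i p≢j)) (half (indicator S' p))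
        both : ∀ {T} → (∀ A → A ∈T T → ∣ A ∣ ≡ k) → cell T m → S ∈T T × S' ∈T T
        both {T} sub c = support-edge sub e kS {m} agree 0<mi c , support-edge sub (adj-sym e) kS' {m} agree' 0<mj c

      ≤b : ∀ {S} → S ∈T T₁ → v S ≤ b
      ≤b {S} m = valid (indicator S) (vertex {P = S} m)

      ≡b : ∀ {S} → S ∈T T₁ → S ∈T T₂ → v S ≡ b
      ≡b {S} m m' = proj₂ (proj₁ (char (indicator S)) (vertex {P = S} m , vertex {P = S} m'))

      ≡b⇒∈T₂ : ∀ {S} → S ∈T T₁ → v S ≡ b → S ∈T T₂
      ≡b⇒∈T₂ {S} m e = vertex-∈ (proj₂ (element S (sub₁ S m)))
          (proj₂ (proj₂ (char (indicator S)) (vertex {P = S} m , e)))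

    classification : ∃₂ λ A j → SplitData k A j × (T₁ , T₂) ≡ splitOf k A j
    classification =
      let Z₀ , Z₀∈V₁ = difference {T = T₁} {T₂} ⊈₁
          W₀ , W₀∈V₂ = difference {T = T₂} {T₁} ⊈₂
      in Separation.classification T₁ T₂ a b sub₁ sub₂ covered edge ≤b ≡b ≡b⇒∈T₂ Z₀ Z₀∈V₁ W₀ W₀∈V₂

open Polytopes

-- Distinct hyperplanes give distinct splits

module Counting where
  open import Data.Nat
  open import Data.Nat.Properties
  open import Data.Nat.Combinatorics using (_C_; nCk+nC[k+1]≡[n+1]C[k+1]; nC1≡n)
  open import Data.Nat.ListAction using (sum)
  open import Data.Nat.ListAction.Properties using (sum-++)
  open import Data.Nat.Solver using (module +-*-Solver)
  import Data.Integer as ℤ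
  import Data.Integer.Properties as ℤ
  import Data.Integer.Solver as ℤSolver
  open import Data.List.Membership.Propositional.Properties using (∈-++⁺ˡ; ∈-++⁺ʳ; ∈-map⁺; ∈-map⁻)
  open import Data.List.Properties using (length-++; length-map; upTo-∷ʳ; map-++)
  import Data.List.Relation.Unary.All.Properties as All
  open import Data.List.Relation.Unary.AllPairs as AllPairs using (AllPairs; []; _∷_)
  import Data.List.Relation.Unary.AllPairs.Properties as AllPairs
  open import Data.List.Relation.Unary.Unique.Propositional using (Unique)
  import Data.List.Relation.Unary.Unique.Propositional.Properties as Unique

  splitData-∁ : ∀ {k j} {A : Subset n} → SplitData k A j → SplitData k (∁ A) (k ∸ j)
  splitData-∁ {A = A} (splitData 1≤j j<k j<A j<∁A) = splitData (m<n⇒0<n∸m j<k)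
    (∸-monoʳ-< 1≤j (<⇒≤ j<k)) j<∁A
    (subst₂ _<_ (sym (m∸[m∸n]≡n (<⇒≤ j<k))) (cong ∣_∣ (sym (∁-involutive A))) j<A)

  sameSplit-sym : ∀ {s t : Table n × Table n} → SameSplit s t → SameSplit t s
  sameSplit-sym (inj₁ (p , q)) = inj₁ (sym p , sym q)
  sameSplit-sym (inj₂ (p , q)) = inj₂ (sym q , sym p)

  module _ {k : ℕ} where

    -- The vertices on the splitting hyperplane are those in both cells.
    same-hyperplane : ∀ {A A' : Subset n} {j j'} → j ≤ k → j' ≤ k → SameSplit (splitOf k A j) (splitOf k A' j') →
                      ∀ S → ∣ S ∣ ≡ k → cnt A S ≡ j → cnt A' S ≡ j'
    same-hyperplane {A = A} {A'} {j} {j'} j≤k j'≤k same S card e = both (transfer same)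
      where
      lo : S ∈T lowTable k A j
      lo = ∈low⁺ k A j card (≤-reflexive e)
      hi : S ∈T lowTable k (∁ A) (k ∸ j)
      hi = ∈low⁺ k (∁ A) (k ∸ j) card (⇒high k A {j} S card (≤-reflexive (sym e)))
      transfer : SameSplit (splitOf k A j) (splitOf k A' j') → S ∈T lowTable k A' j' × S ∈T
          lowTable k (∁ A') (k ∸ j')
      transfer (inj₁ (p , q)) = subst (S ∈T_) p lo , subst (S ∈T_) q hi
      transfer (inj₂ (p , q)) = subst (S ∈T_) q hi , subst (S ∈T_) p lo
      both : S ∈T lowTable k A' j' × S ∈T lowTable k (∁ A') (k ∸ j') → cnt A' S ≡ j'
      both (l , h) = ≤-antisym (proj₂ (∈low⁻ k A' j' l))
          (high⇒ k A' j'≤k S card (proj₂ (∈low⁻ k (∁ A') (k ∸ j') h)))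

    -- Exchanging p and q leaves the hyperplane of (A, j), hence also that of (A', j').
    separates : ∀ {A A' : Subset n} {j j'} → SplitData k A j →
                (∀ S → ∣ S ∣ ≡ k → cnt A S ≡ j → cnt A' S ≡ j') → (∀ S → ∣ S ∣ ≡ k → cnt A' S ≡ j' → cnt A S ≡ j) →
                ∀ {p q} → p ∈ᵇ A → q ∉ᵇ A → lookup A' p ≢ lookup A' q
    separates {A = A} {A'} {j} {j'} (splitData 1≤j j<k j<A j<∁A) to from {p} {q} p∈A q∉A eq
      with pickThrough A j (k ∸ j) 1≤j (<⇒≤ j<A) j<∁A p∈A q∉A
    ... | S , cntS , card , p∈S , q∉S = 1+n≢n
        (trans (sym down) (trans cntS (sym (from S' card' (trans stay (to S card₀ cntS))))))
      where
      S' = swap S p q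
      e = swap-adj S p∈S q∉S
      card₀ : ∣ S ∣ ≡ k
      card₀ = trans card (m+[n∸m]≡n (<⇒≤ j<k))
      card' : ∣ S' ∣ ≡ k
      card' = trans (card-adj e) card₀
      stay : cnt A' S' ≡ cnt A' S
      stay = +-cancelˡ-≡ (bit (lookup A' p)) _ _
          (trans (sym (cnt-adj A' e)) (cong (λ b → bit b + cnt A' S) (sym eq)))
      down : cnt A S ≡ suc (cnt A S')
      down = subst₂ (λ b c → bit b + cnt A S ≡ bit c + cnt A S') q∉A p∈A (cnt-adj A e)

    -- Two positions separated by one of `A`, `A'` are separated by the other, so both define the
    -- same two blocks, and `zero` tells which block is meant. Any vertex on the common hyperplane
    -- then fixes the level.
    splitOf-injective : ∀ {A A' : Subset (suc n)} {j j'} → SplitData k A j → SplitData k A' j' →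
                        zero ∈ᵇ A → zero ∈ᵇ A' → SameSplit (splitOf k A j) (splitOf k A' j') → A ≡ A' × j ≡ j'
    splitOf-injective {A = A} {A'} {j} {j'} d d' 0∈A 0∈A' same = A≡A' , j≡j'
      where
      j≤k = <⇒≤ (SplitData.j<k d)
      j'≤k = <⇒≤ (SplitData.j<k d')
      to = same-hyperplane {A = A} {A'} j≤k j'≤k same
      from = same-hyperplane {A = A'} {A} j'≤k j≤k (sameSplit-sym {s = splitOf k A j} {t = splitOf k A' j'} same)
      pointwise : ∀ p → lookup A p ≡ lookup A' p
      pointwise p with ∈-or-∉ A p | ∈-or-∉ A' p
      ... | inj₁ x | inj₁ y = trans x (sym y)
      ... | inj₂ x | inj₂ y = trans x (sym y)
      ... | inj₁ x | inj₂ y = contradiction (trans 0∈A (sym x)) (separates {A = A'} {A} d' from to 0∈A' y)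
      ... | inj₂ x | inj₁ y = contradiction (trans 0∈A' (sym y)) (separates {A = A} {A'} d to from 0∈A x)
      A≡A' : A ≡ A'
      A≡A' = lookup-ext A A' pointwise
      j≡j' : j ≡ j'
      j≡j' with pickCounts A j (k ∸ j) (<⇒≤ (SplitData.j<A d)) (<⇒≤ (SplitData.j<∁A d))
      ... | S , e , f = trans (sym e) (trans (cong (λ B → cnt B S) A≡A')
             (to S (trans (sym (cnt-∁ A S)) (trans (cong₂ _+_ e f) (m+[n∸m]≡n j≤k))) e))

  -- Subsets with at least `r` elements inside and at least `s` outside

  subsets : (N r s : ℕ) → List (Subset N)
  subsets zero    zero    zero    = [] ∷ []
  subsets zero    zero    (suc s) = []
  subsets zero    (suc r) s       = []
  -- A bound that is already met stays at 0 under `pred`.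
  subsets (suc N) r       s       = map (true ∷_) (subsets N (pred r) s) ++ map (false ∷_) (subsets N r (pred s))

  subsets-sound : ∀ N r s → All (λ A → r ≤ ∣ A ∣ × s ≤ ∣ ∁ A ∣) (subsets N r s)
  subsets-sound zero zero zero = (z≤n , z≤n) ∷ []
  subsets-sound zero zero (suc s) = []
  subsets-sound zero (suc r) s = []
  subsets-sound (suc N) r s = All.++⁺
    (All.map⁺ (All.map (λ (p , q) → ≤-pred⁻ p , q) (subsets-sound N (pred r) s)))
    (All.map⁺ (All.map (λ (p , q) → p , ≤-pred⁻ q) (subsets-sound N r (pred s))))
    where
    ≤-pred⁻ : ∀ {a b} → pred a ≤ b → a ≤ suc b
    ≤-pred⁻ {zero} h = z≤n
    ≤-pred⁻ {suc a} h = s≤s h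

  subsets-complete : ∀ {N r s} (A : Subset N) → r ≤ ∣ A ∣ → s ≤ ∣ ∁ A ∣ → A ∈ subsets N r s
  subsets-complete [] z≤n z≤n = here refl
  subsets-complete {r = r} {s} (true ∷ A) p q = ∈-++⁺ˡ (∈-map⁺ (true ∷_) (subsets-complete A (pred-mono-≤ p) q))
  subsets-complete {suc N} {r} {s} (false ∷ A) p q =
    ∈-++⁺ʳ (map (true ∷_) (subsets N (pred r) s)) (∈-map⁺ (false ∷_) (subsets-complete A p (pred-mono-≤ q)))

  subsets-unique : ∀ N r s → Unique (subsets N r s)
  subsets-unique zero zero zero = [] ∷ []
  subsets-unique zero zero (suc s) = []
  subsets-unique zero (suc r) s = []
  subsets-unique (suc N) r s = Unique.++⁺
    (Unique.map⁺ (λ { refl → refl }) (subsets-unique N (pred r) s))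
    (Unique.map⁺ (λ { refl → refl }) (subsets-unique N r (pred s)))
    λ (p , q) → disjoint (∈-map⁻ (true ∷_) p) (∈-map⁻ (false ∷_) q)
    where
    disjoint : ∀ {A : Subset (suc N)} {xs ys} → (∃ λ x → x ∈ xs × A ≡ true ∷ x) → ¬ (∃ λ y → y ∈ ys × A ≡ false ∷ y)
    disjoint (_ , _ , refl) (_ , _ , ())

  -- The number of subsets of an N-element set with fewer than m elements.
  fewer : (N m : ℕ) → ℕ
  fewer zero    zero    = 0
  fewer zero    (suc m) = 1
  fewer (suc N) zero    = 0
  fewer (suc N) (suc m) = fewer N m + fewer N (suc m)

  fewer-0 : ∀ N → fewer N 0 ≡ 0
  fewer-0 zero = refl
  fewer-0 (suc N) = refl

  module _ where
    open +-*-Solver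

    length-subsets-suc : ∀ N r s → length (subsets (suc N) r s) ≡ length (subsets N (pred r) s) +
        length (subsets N r (pred s))
    length-subsets-suc N r s = trans (length-++ (map (true ∷_) (subsets N (pred r) s)))
      (cong₂ _+_ (length-map _ (subsets N (pred r) s)) (length-map _ (subsets N r (pred s))))

    length-subsets-0ˡ : ∀ N s → length (subsets N 0 s) + fewer N s ≡ 2 ^ N
    length-subsets-0ˡ zero zero = refl
    length-subsets-0ˡ zero (suc s) = refl
    length-subsets-0ˡ (suc N) zero rewrite length-subsets-suc N 0 0 = trans
      (cong₂ (λ x y → x + y + 0) (base N) (base N)) (solve 1 (λ x → x :+ x :+ con 0 := con 2 :* x) refl (2 ^ N))
      where
      base : ∀ N → length (subsets N 0 0) ≡ 2 ^ N
      base N = trans (sym (+-identityʳ _))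
          (trans (cong (length (subsets N 0 0) +_) (sym (fewer-0 N))) (length-subsets-0ˡ N 0))
    length-subsets-0ˡ (suc N) (suc s) rewrite length-subsets-suc N 0 (suc s) = trans
      (solve 4 (λ a b c d → a :+ b :+ (d :+ c) := (a :+ c) :+ (b :+ d)) refl
        (length (subsets N 0 (suc s))) (length (subsets N 0 s)) (fewer N (suc s)) (fewer N s))
      (trans (cong₂ _+_ (length-subsets-0ˡ N (suc s)) (length-subsets-0ˡ N s))
          (solve 1 (λ x → x :+ x := con 2 :* x) refl (2 ^ N)))

    length-subsets-0ʳ : ∀ N r → length (subsets N r 0) + fewer N r ≡ 2 ^ N
    length-subsets-0ʳ N zero = length-subsets-0ˡ N 0
    length-subsets-0ʳ zero (suc r) = refl
    length-subsets-0ʳ (suc N) (suc r) rewrite length-subsets-suc N (suc r) 0 = trans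
      (solve 4 (λ a b c d → b :+ a :+ (d :+ c) := (a :+ c) :+ (b :+ d)) refl
        (length (subsets N (suc r) 0)) (length (subsets N r 0)) (fewer N (suc r)) (fewer N r))
      (trans (cong₂ _+_ (length-subsets-0ʳ N (suc r)) (length-subsets-0ʳ N r))
          (solve 1 (λ x → x :+ x := con 2 :* x) refl (2 ^ N)))

    -- The missing sets have fewer than `r` elements inside or fewer than `s` outside. Both at once
    -- would give `N ≤ r + s - 2`, so the hypothesis makes the two families disjoint. It passes to
    -- both recursive calls, since each lowers one bound along with `N`.
    length-subsets : ∀ N r s → r + s ≤ suc N → length (subsets N r s) + (fewer N r + fewer N s) ≡ 2 ^ N
    length-subsets N zero s h rewrite fewer-0 N = length-subsets-0ˡ N s
    length-subsets N (suc r) zero h rewrite fewer-0 N | +-identityʳ (fewer N (suc r)) = length-subsets-0ʳ N (suc r)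
    length-subsets zero (suc r) (suc s) (s≤s h) = contradiction (subst (_≤ 0) (+-suc r s) h) λ ()
    length-subsets (suc N) (suc r) (suc s) (s≤s h) rewrite length-subsets-suc N (suc r) (suc s) = trans
      (solve 6 (λ a b c d e f → a :+ b :+ (c :+ d :+ (e :+ f)) := a :+ (c :+ f) :+ (b :+ (d :+ e))) refl
        (length (subsets N r (suc s))) (length (subsets N (suc r) s)) (fewer N r) (fewer N (suc r))
            (fewer N s) (fewer N (suc s)))
      (trans (cong₂ _+_ (length-subsets N r (suc s) h)
          (length-subsets N (suc r) s (subst (_≤ suc N) (+-suc r s) h)))
        (solve 1 (λ x → x :+ x := con 2 :* x) refl (2 ^ N)))

    fewer-suc : ∀ n m → fewer n (suc m) ≡ fewer n m + n C m
    fewer-suc zero zero = refl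
    fewer-suc zero (suc m) = refl
    fewer-suc (suc n) zero = trans (cong (_+ fewer n 1) (fewer-0 n))
        (trans (fewer-suc n 0) (cong (_+ 1) (fewer-0 n)))
    fewer-suc (suc n) (suc m) = begin
      fewer n (suc m) + fewer n (suc (suc m))                     ≡⟨ cong₂ _+_ (fewer-suc n m)
          (fewer-suc n (suc m)) ⟩
      fewer n m + n C m + (fewer n (suc m) + n C suc m)           ≡⟨ solve 4
          (λ a b c d → a :+ b :+ (c :+ d) := a :+ c :+ (b :+ d)) refl (fewer n m) (n C m) (fewer n (suc m))
          (n C suc m) ⟩
      fewer n m + fewer n (suc m) + (n C m + n C suc m)           ≡⟨ cong (fewer n m + fewer n (suc m) +_)
          (nCk+nC[k+1]≡[n+1]C[k+1] n m) ⟩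
      fewer n m + fewer n (suc m) + suc n C suc m                 ∎
      where open ≡-Reasoning

    fewer-2 : ∀ n → fewer n 2 ≡ n + 1
    fewer-2 n = trans (fewer-suc n 1)
        (trans (cong₂ _+_ (trans (fewer-suc n 0) (cong (_+ 1) (fewer-0 n))) (nC1≡n n)) (+-comm 1 n))

    -- Finite sums and the closed formula

    ∑ : ℕ → (ℕ → ℕ) → ℕ
    ∑ zero    f = 0
    ∑ (suc c) f = f c + ∑ c f

    ∑-cong : ∀ c {f g : ℕ → ℕ} → (∀ i → i < c → f i ≡ g i) → ∑ c f ≡ ∑ c g
    ∑-cong zero h = refl
    ∑-cong (suc c) h = cong₂ _+_ (h c ≤-refl) (∑-cong c (λ i i<c → h i (m≤n⇒m≤1+n i<c)))

    ∑-+ : ∀ c f g → ∑ c (λ i → f i + g i) ≡ ∑ c f + ∑ c g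
    ∑-+ zero f g = refl
    ∑-+ (suc c) f g rewrite ∑-+ c f g = solve 4 (λ a b x y → a :+ b :+ (x :+ y) := a :+ x :+ (b :+ y)) refl
        (f c) (g c) (∑ c f) (∑ c g)

    ∑-const : ∀ c m → ∑ c (λ _ → m) ≡ c * m
    ∑-const zero m = refl
    ∑-const (suc c) m = cong (m +_) (∑-const c m)

    ∑-first : ∀ c f → ∑ (suc c) f ≡ f 0 + ∑ c (f ∘ suc)
    ∑-first zero f = refl
    ∑-first (suc c) f rewrite ∑-first c f = solve 3 (λ a b x → a :+ (b :+ x) := b :+ (a :+ x)) refl
        (f (suc c)) (f 0) (∑ c (f ∘ suc))

    ∑-reverse : ∀ c (g : ℕ → ℕ) → ∑ c (λ i → g (c ∸ i)) ≡ ∑ c (g ∘ suc)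
    ∑-reverse zero g = refl
    ∑-reverse (suc c) g = begin
      g (suc c ∸ c) + ∑ c (λ i → g (suc c ∸ i))   ≡⟨ cong₂ _+_
          (cong g (trans (+-∸-assoc 1 (≤-refl {c})) (cong suc (n∸n≡0 c))))
                                                         (∑-cong c (λ i i<c → cong g (+-∸-assoc 1 (<⇒≤ i<c)))) ⟩
      g 1 + ∑ c (λ i → (g ∘ suc) (c ∸ i))         ≡⟨ cong (g 1 +_) (∑-reverse c (g ∘ suc)) ⟩
      g 1 + ∑ c (λ i → g (2 + i))                   ≡⟨ ∑-first c (g ∘ suc) ⟨
      ∑ (suc c) (g ∘ suc)                         ∎
      where open ≡-Reasoning

    sum-upTo : ∀ (f : ℕ → ℕ) m → sum (map f (upTo m)) ≡ ∑ m f
    sum-upTo f zero = refl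
    sum-upTo f (suc m) = begin
      sum (map f (upTo (suc m)))       ≡⟨ cong (sum ∘ map f) (upTo-∷ʳ m) ⟨
      sum (map f (upTo m ++ m ∷ []))   ≡⟨ cong sum (map-++ f (upTo m) (m ∷ [])) ⟩
      sum (map f (upTo m) ++ f m ∷ []) ≡⟨ sum-++ (map f (upTo m)) (f m ∷ []) ⟩
      sum (map f (upTo m)) + (f m + 0) ≡⟨ cong₂ _+_ (sum-upTo f m) (+-identityʳ (f m)) ⟩
      ∑ m f + f m                      ≡⟨ +-comm (∑ m f) (f m) ⟩
      f m + ∑ m f                      ∎
      where open ≡-Reasoning

    module _ (n : ℕ) where
      -- The binomials for 0 and 1 are collected in `n + 1`, the constant that appears in the
      -- formula.
      fewer-∑ : ∀ M → fewer n (2 + M) ≡ n + 1 + ∑ M (λ j → n C (2 + j))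
      fewer-∑ zero = trans (fewer-2 n) (sym (+-identityʳ (n + 1)))
      fewer-∑ (suc M) = begin
        fewer n (3 + M)                                              ≡⟨ fewer-suc n (2 + M) ⟩
        fewer n (2 + M) + n C (2 + M)                                ≡⟨ cong (_+ n C (2 + M)) (fewer-∑ M) ⟩
        n + 1 + ∑ M (λ j → n C (2 + j)) + n C (2 + M)                ≡⟨ solve 3
            (λ a b c → a :+ b :+ c := a :+ (c :+ b)) refl (n + 1) (∑ M (λ j → n C (2 + j))) (n C (2 + M)) ⟩
        n + 1 + (n C (2 + M) + ∑ M (λ j → n C (2 + j)))              ∎
        where open ≡-Reasoning

      -- The order of summation is changed: `n C (2 + j)` occurs in the terms with `j < i ≤ M`,
      -- which are `M ∸ j` in number.
      ∑-fewer : ∀ M → ∑ (suc M) (λ i → fewer n (2 + i)) ≡ suc M * (n + 1) + ∑ M (λ j → (M ∸ j) * (n C (2 + j)))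
      ∑-fewer zero = cong (_+ 0) (trans (fewer-2 n) (sym (+-identityʳ (n + 1))))
      ∑-fewer (suc M) = begin
        fewer n (3 + M) + ∑ (suc M) (λ i → fewer n (2 + i))
          ≡⟨ cong₂ _+_ (fewer-∑ (suc M)) (∑-fewer M) ⟩
        n + 1 + (n C (2 + M) + ∑ M c) + (suc M * (n + 1) + ∑ M (λ j → (M ∸ j) * c j))
          ≡⟨ solve 5 (λ a x y b z → a :+ (x :+ y) :+ (b :+ z) := (a :+ b) :+ (x :+ (y :+ z))) refl
               (n + 1) (n C (2 + M)) (∑ M c) (suc M * (n + 1)) (∑ M (λ j → (M ∸ j) * c j)) ⟩
        suc (suc M) * (n + 1) + (c M + (∑ M c + ∑ M (λ j → (M ∸ j) * c j)))
          ≡⟨ cong (suc (suc M) * (n + 1) +_)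
              (cong₂ _+_ top (trans (sym (∑-+ M c (λ j → (M ∸ j) * c j))) (∑-cong M rest))) ⟩
        suc (suc M) * (n + 1) + ((suc M ∸ M) * c M + ∑ M (λ j → (suc M ∸ j) * c j))
          ∎
        where
        open ≡-Reasoning
        c : ℕ → ℕ
        c j = n C (2 + j)
        top : c M ≡ (suc M ∸ M) * c M
        top = sym (trans (cong (_* c M) (trans (+-∸-assoc 1 (≤-refl {M})) (cong suc (n∸n≡0 M))))
            (+-identityʳ (c M)))
        rest : ∀ j → j < M → c j + (M ∸ j) * c j ≡ (suc M ∸ j) * c j
        rest j j<M = cong (_* c j) (sym (+-∸-assoc 1 (<⇒≤ j<M)))

      ∑-fewer-sumTerm : ∀ K → ∑ K (λ i → fewer n (2 + i)) ≡ K * (n + 1) + sumTerm (suc K) n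
      ∑-fewer-sumTerm zero = refl
      ∑-fewer-sumTerm (suc M) = trans (∑-fewer M) (cong (suc M * (n + 1) +_)
        -- At `i = 2 + j` the coefficient `2 + M ∸ i` computes to `M ∸ j`.
        (trans (∑-cong M (λ j _ → cong (λ i → (2 + M ∸ i) * (n C i)) (+-comm 2 j)))
               (sym (sum-upTo (λ j → (2 + M ∸ (j + 2)) * (n C (j + 2))) M))))

  -- The list of all splits and its length

  -- (j , A) with 1 ≤ j ≤ c encodes the split of {0} ∪ A at level j.
  levels : (k N c : ℕ) → List (ℕ × Subset N)
  levels k N zero    = []
  levels k N (suc c) = map (suc c ,_) (subsets N (suc c) (k ∸ c)) ++ levels k N c

  module _ (k N : ℕ) where

    toSplit : ℕ × Subset N → Table (suc N) × Table (suc N)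
    toSplit (j , A) = splitOf k (true ∷ A) j

    Valid : ℕ × Subset N → Set
    Valid (j , A) = SplitData k (true ∷ A) j

    -- The element 0 weakens `j < ∣ A ∣` to `j` being at most the size of the rest, and `k ∸ c` is
    -- the successor of `k ∸ suc c`, which encodes the strict bound on the complement. The bound by
    -- `c` keeps the levels disjoint.
    levels-sound : ∀ c → c < k → All (λ x → Valid x × proj₁ x ≤ c) (levels k N c)
    levels-sound zero h = []
    levels-sound (suc c) h = All.++⁺
      (All.map⁺ (All.map (λ {A} (p , q) → splitData (s≤s z≤n) h (s≤s p)
          (subst (_≤ ∣ ∁ A ∣) (+-∸-assoc 1 (<⇒≤ h)) q) , ≤-refl) (subsets-sound N (suc c) (k ∸ c))))
      (All.map (λ (p , q) → p , m≤n⇒m≤1+n q) (levels-sound c (<⇒≤ h)))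

    levels-unique : ∀ c → c < k → Unique (levels k N c)
    levels-unique zero _ = []
    levels-unique (suc c) h = Unique.++⁺
      (Unique.map⁺ (λ { refl → refl }) (subsets-unique N (suc c) (k ∸ c))) (levels-unique c (<⇒≤ h))
      λ (p , q) → disjoint (∈-map⁻ (suc c ,_) p) (proj₂ (All.lookup (levels-sound c (<⇒≤ h)) q))
      where
      disjoint : ∀ {x xs} → (∃ λ (y : Subset N) → y ∈ xs × x ≡ (suc c , y)) → ¬ (proj₁ x ≤ c)
      disjoint (_ , _ , refl) = <-irrefl refl

    levels-complete : ∀ c {j A} → j ≤ c → Valid (j , A) → (j , A) ∈ levels k N c
    levels-complete zero z≤n (splitData () _ _ _)
    levels-complete (suc c) {j} {A} le d with m≤n⇒m<n∨m≡n le
    ... | inj₁ (s≤s lt) = ∈-++⁺ʳ (map (suc c ,_) (subsets N (suc c) (k ∸ c))) (levels-complete c lt d)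
    ... | inj₂ refl = ∈-++⁺ˡ (∈-map⁺ (suc c ,_) (subsets-complete A (≤-pred (SplitData.j<A d))
                        (subst (_≤ ∣ ∁ A ∣) (sym (+-∸-assoc 1 (<⇒≤ (SplitData.j<k d)))) (SplitData.j<∁A d))))

    length-levels : ∀ c → length (levels k N c) ≡ ∑ c (λ i → length (subsets N (suc i) (k ∸ i)))
    length-levels zero = refl
    length-levels (suc c) = trans (length-++ (map (suc c ,_) (subsets N (suc c) (k ∸ c))) {levels k N c})
      (cong₂ _+_ (length-map {B = ℕ × Subset N} (suc c ,_) (subsets N (suc c) (k ∸ c))) (length-levels c))

  -- Injectivity of `toSplit` is available for valid codes, so validity has to accompany
  -- distinctness.
  allPairs-with : ∀ {X : Set} {P : X → Set} {R : X → X → Set} {xs} → All P xs → AllPairs R xs →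
                  AllPairs (λ x y → P x × P y × R x y) xs
  allPairs-with [] [] = []
  allPairs-with (p ∷ ps) (r ∷ rs) = All.map (λ (q , s) → p , q , s) (All.zip (ps , r)) ∷ allPairs-with ps rs

  module _ {k N : ℕ} (1≤k : 1 ≤ k) where
    private
      xs = levels k N (pred k)
      pred<k : pred k < k
      pred<k = ≤-reflexive (suc-pred k {{>-nonZero 1≤k}})
      valid : All (Valid k N) xs
      valid = All.map proj₁ (levels-sound k N (pred k) pred<k)

    splits : List (Table (suc N) × Table (suc N))
    splits = map (toSplit k N) xs

    listed : ∀ (A : Subset (suc N)) {j} → zero ∈ᵇ A → SplitData k A j → splitOf k A j ∈ splits
    listed (true ∷ A) refl d = ∈-map⁺ (toSplit k N) (levels-complete k N (pred k) (pred-mono-≤ (SplitData.j<k d)) d)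

    splits-complete : ∀ s → IsSplit k (suc N) s → Σ _ λ t → t ∈ splits × SameSplit s t
    splits-complete (T₁ , T₂) isSplit = go (Completeness.classification 1≤k T₁ T₂ isSplit)
      where
      go : (∃₂ λ A j → SplitData k A j × (T₁ , T₂) ≡ splitOf k A j) → Σ _ λ t → t ∈ splits × SameSplit (T₁ , T₂) t
      go (A , j , d , refl) with ∈-or-∉ A zero
      ... | inj₁ 0∈A = splitOf k A j , listed A 0∈A d , inj₁ (refl , refl)
      ... | inj₂ 0∉A = _ , subst (_∈ splits) (splitOf-∁ k A (<⇒≤ (SplitData.j<k d)))
                              (listed (∁ A) (∉⇒∈∁ A 0∉A) (splitData-∁ d)) , inj₂ (refl , refl)

    splitList : SplitList k (suc N) splits
    splitList =
        All.map⁺ (All.map (λ {x} d → splitOf-isSplit k (true ∷ proj₂ x) d) valid)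
      , splits-complete
      , AllPairs.map⁺ (AllPairs.map distinct (allPairs-with valid (levels-unique k N (pred k) pred<k)))
      where
      distinct : ∀ {x y} → Valid k N x × Valid k N y × x ≢ y → ¬ SameSplit (toSplit k N x) (toSplit k N y)
      distinct {j , A} {j' , A'} (d , d' , x≢y) same with splitOf-injective d d' refl refl same
      ... | refl , refl = x≢y refl

  module _ {K N : ℕ} (k≤N : suc K ≤ N) where

    length-splits : length (splits {suc K} {N} (s≤s z≤n)) + (K * (suc N + 1) + sumTerm (suc K) (suc N)) ≡ K * 2 ^ N
    length-splits = begin
      length (splits {suc K} {N} (s≤s z≤n)) + (K * (suc N + 1) + sumTerm (suc K) (suc N))
        ≡⟨ cong₂ _+_ (trans (length-map _ (levels (suc K) N K)) (length-levels (suc K) N K))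
            (sym (∑-fewer-sumTerm (suc N) K)) ⟩
      -- The new summand is `fewer (suc N) (2 + i)` unfolded: Pascal's rule is the defining equation
      -- of `fewer`.
      ∑ K e + ∑ K (λ i → fewer N (suc i) + fewer N (2 + i))
        ≡⟨ cong (∑ K e +_) (∑-+ K (λ i → fewer N (suc i)) (λ i → fewer N (2 + i))) ⟩
      ∑ K e + (∑ K (λ i → fewer N (suc i)) + ∑ K (λ i → fewer N (2 + i)))
        ≡⟨ cong (λ t → ∑ K e + (∑ K (λ i → fewer N (suc i)) + t)) (∑-reverse K (fewer N ∘ suc)) ⟨
      ∑ K e + (∑ K (λ i → fewer N (suc i)) + ∑ K (λ i → fewer N (suc (K ∸ i))))
        ≡⟨ cong (∑ K e +_) (∑-+ K (λ i → fewer N (suc i)) (λ i → fewer N (suc (K ∸ i)))) ⟨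
      ∑ K e + ∑ K (λ i → fewer N (suc i) + fewer N (suc (K ∸ i)))
        ≡⟨ ∑-+ K e (λ i → fewer N (suc i) + fewer N (suc (K ∸ i))) ⟨
      ∑ K (λ i → e i + (fewer N (suc i) + fewer N (suc (K ∸ i))))
        ≡⟨ ∑-cong K term ⟩
      ∑ K (λ _ → 2 ^ N)
        ≡⟨ ∑-const K (2 ^ N) ⟩
      K * 2 ^ N ∎
      where
      open ≡-Reasoning
      e : ℕ → ℕ
      e i = length (subsets N (suc i) (suc K ∸ i))
      term : ∀ i → i < K → e i + (fewer N (suc i) + fewer N (suc (K ∸ i))) ≡ 2 ^ N
      term i i<K = trans (cong (λ m → e i + (fewer N (suc i) + fewer N m)) (sym (+-∸-assoc 1 (<⇒≤ i<K))))
        (length-subsets N (suc i) (suc K ∸ i) (s≤s (≤-trans (≤-reflexive (m+[n∸m]≡n (m≤n⇒m≤1+n (<⇒≤ i<K)))) k≤N)))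

    splitCount-eq : ℤ.+ length (splits {suc K} {N} (s≤s z≤n)) ≡ splitCount (suc K) (suc N)
    splitCount-eq = begin
      ℤ.+ l
        ≡⟨ solve 2 (λ x y → x := (x :+ y) :- y) refl (ℤ.+ l) (ℤ.+ (K * m + t)) ⟩
      (ℤ.+ l ℤ.+ ℤ.+ (K * m + t)) ℤ.- ℤ.+ (K * m + t)
        ≡⟨ cong (ℤ._- ℤ.+ (K * m + t)) (trans (sym (ℤ.pos-+ l (K * m + t)))
            (trans (cong ℤ.+_ length-splits) (ℤ.pos-* K (2 ^ N)))) ⟩
      ℤ.+ K ℤ.* ℤ.+ (2 ^ N) ℤ.- ℤ.+ (K * m + t)
        ≡⟨ cong (λ z → ℤ.+ K ℤ.* ℤ.+ (2 ^ N) ℤ.- z) (trans (ℤ.pos-+ (K * m) t) (cong (ℤ._+ ℤ.+ t) (ℤ.pos-* K m))) ⟩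
      ℤ.+ K ℤ.* ℤ.+ (2 ^ N) ℤ.- (ℤ.+ K ℤ.* ℤ.+ m ℤ.+ ℤ.+ t)
        ≡⟨ solve 4 (λ x p m t → x :* p :- (x :* m :+ t) := x :* (p :- m) :- t) refl (ℤ.+ K) (ℤ.+ (2 ^ N))
            (ℤ.+ m) (ℤ.+ t) ⟩
      ℤ.+ K ℤ.* (ℤ.+ (2 ^ N) ℤ.- ℤ.+ m) ℤ.- ℤ.+ t ∎
      where
      open ≡-Reasoning
      open ℤSolver.+-*-Solver
      l = length (splits {suc K} {N} (s≤s z≤n))
      m = suc N + 1
      t = sumTerm (suc K) (suc N)

  -- In terms of `k` and `n` this is `k ≤ n - 1`, the form in which `length-subsets` obtains its
  -- disjointness condition.
  half-bound : ∀ {K N} → 2 * suc K ≤ suc N → suc K ≤ N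
  half-bound {K} {N} h = ≤-pred (begin
    2 + K             ≤⟨ s≤s (m≤n+m (suc K) K) ⟩
    suc (K + suc K)   ≡⟨ cong (λ m → suc (K + m)) (+-identityʳ (suc K)) ⟨
    2 * suc K         ≤⟨ h ⟩
    suc N             ∎)
    where open ≤-Reasoning

open Counting using (splits; splitList; splitCount-eq; half-bound)
open import Data.Nat using (_≤_; _*_)
open import Data.Integer using (+_)

theorem5p3 : (n k : ℕ) → 2 ≤ n → 1 ≤ k → 2 * k ≤ n →
    Σ (List _) λ L → SplitList k n L × (+ length L) ≡ splitCount k n
theorem5p3 (suc N) (suc K) _ _ 2k≤n = splits (s≤s z≤n) , splitList (s≤s z≤n) , splitCount-eq (half-bound 2k≤n)
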